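{- Over any field, abelian diagonalizable Lie algebra conjugacy is GI-hard; that is, the graph isomorphism problem reduces in polynomial time to the Lie algebra conjugacy problem restricted to abelian diagonalizable matrix Lie algebras (of unbounded dimension).
   Context: A matrix Lie algebra over a field $\mathbb{F}$ is a linear subspace $\mathcal{L}$ of the $n\times n$ matrices over $\mathbb{F}$ closed under $[A,B]:=AB-BA$. It is abelian if all its matrices commute pairwise, and diagonalizable if it is conjugate to a set of diagonal matrices, i.e. $A\mathcal{L}A^{ -1}$ consists of diagonal matrices for some invertible $A$. Lie Algebra Conjugacy (LAC): given two Lie algebras $\mathcal{L}_1,\mathcal{L}_2$ of $n\times n$ matrices, each by a linear basis, output an invertible $n\times n$ matrix $A$ with $A\mathcal{L}_1A^{ -1}=\mathcal{L}_2$ if such $A$ exists, and otherwise report that they are not conjugate. GI denotes the graph isomorphism problem: given two finite graphs, decide whether they are isomorphic. -}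

module Defs where

open import Level using (Level; _⊔_; suc; 0ℓ)
open import Algebra.Bundles using (CommutativeRing)
open import Algebra.Apartness.Bundles using (HeytingField; HeytingCommutativeRing)
import Algebra.Properties.CommutativeMonoid.Sum as Summation
open import Data.Bool.Base using (Bool; true; false; if_then_else_)
open import Data.Fin.Base using (Fin)
open import Data.Fin.Properties using (_≟_)
open import Data.List.Base as List using (List; []; _∷_; _++_; length; replicate; concat; concatMap)
open import Data.Maybe.Base using (Maybe; just; nothing)
open import Data.Nat.Base as ℕ using (ℕ)
open import Data.Product.Base using (Σ; Σ-syntax; ∃; ∃-syntax; _×_; _,_; proj₁)
open import Data.Vec.Base as Vec using (Vec; []; _∷_)
open import Function.Base using (_∘_)
open import Function.Bundles using (_↔_; _⇔_; Inverse)
open import Relation.Binary.PropositionalEquality.Core using (_≡_; _≢_)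
open import Relation.Nullary.Decidable.Core using (does)

------------------------------------------------------------------------
-- Deterministic multitape Turing machines

Word : Set
Word = List Bool

-- `nothing` is the blank.
Symbol : Set
Symbol = Maybe Bool

data Move : Set where
  left right stay : Move

-- A two-way infinite tape: both lists start with the cell nearest to the
-- head, and all cells beyond the ends of the lists are blank.
record Tape : Set where
  constructor tape
  field
    before : List Symbol
    head   : Symbol
    after  : List Symbol

open Tape public

move : Move → Tape → Tape
move stay  t                   = t
move left  (tape []       h r) = tape [] nothing (h ∷ r)
move left  (tape (s ∷ l)  h r) = tape l s (h ∷ r)
move right (tape l h [])       = tape (h ∷ l) nothing []
move right (tape l h (s ∷ r))  = tape (h ∷ l) s r

act : Symbol × Move → Tape → Tape
act (s , m) (tape l _ r) = move m (tape l s r)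

blankTape : Tape
blankTape = tape [] nothing []

wordTape : Word → Tape
wordTape []      = blankTape
wordTape (b ∷ w) = tape [] (just b) (List.map just w)

bitsBeforeBlank : List Symbol → Word
bitsBeforeBlank []            = []
bitsBeforeBlank (nothing ∷ _) = []
bitsBeforeBlank (just b ∷ s)  = b ∷ bitsBeforeBlank s

-- The word between the head (inclusive) and the first blank to its right.
readTape : Tape → Word
readTape t = bitsBeforeBlank (head t ∷ after t)

-- Tape 0 holds the input, tape 1 the output, the others are work tapes.
-- The machine halts when the transition function returns `nothing`.
record Machine : Set₁ where
  field
    workTapes  : ℕ
    State      : Set
    stateCount : ℕ
    finite     : State ↔ Fin stateCount
    start      : State

  tapes : ℕ
  tapes = 2 ℕ.+ workTapes

  field
    transition : State → Vec Symbol tapes → Maybe (State × Vec (Symbol × Move) tapes)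

module Run (M : Machine) where
  open Machine M

  Config : Set
  Config = State × Vec Tape tapes

  initial : Word → Config
  initial w = start , wordTape w ∷ Vec.replicate _ blankTape

  output : Config → Word
  output (_ , _ ∷ t ∷ _) = readTape t

  step : Config → Maybe Config
  step (q , ts) with transition q (Vec.map head ts)
  ... | nothing        = nothing
  ... | just (q′ , as) = just (q′ , Vec.zipWith act as ts)

  -- c ⇓[ t ] d : from c the machine halts in d after at most t steps.
  data _⇓[_]_ : Config → ℕ → Config → Set where
    halted : ∀ {c t} → step c ≡ nothing → c ⇓[ t ] c
    next   : ∀ {c c′ d t} → step c ≡ just c′ → c′ ⇓[ t ] d → c ⇓[ ℕ.suc t ] d

-- As usual for functions between encoded objects, only the behaviour on
-- words that encode an object is constrained.
PolynomialTime : ∀ {a b} {A : Set a} {B : Set b} →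
                 (A → Word) → (B → Word) → (A → B) → Set (suc 0ℓ ⊔ a)
PolynomialTime encodeA encodeB f =
  Σ[ M ∈ Machine ] let open Run M in
  Σ[ a ∈ ℕ ] Σ[ k ∈ ℕ ] ∀ x → Σ[ d ∈ Config ]
    initial (encodeA x) ⇓[ a ℕ.* length (encodeA x) ℕ.^ k ℕ.+ a ] d ×
    output d ≡ encodeB (f x)

------------------------------------------------------------------------
-- Problems and reductions

-- To solve an instance is to return a solution if there is one and to
-- report that there is none otherwise.
record Problem i s : Set (suc (i ⊔ s)) where
  field
    Instance : Set i
    encode   : Instance → Word
    Solution : Instance → Set s

Restrict : ∀ {i s p} (P : Problem i s) → (Problem.Instance P → Set p) → Problem (i ⊔ p) s
Restrict P R = record
  { Instance = Σ Instance R
  ; encode   = encode ∘ proj₁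
  ; Solution = Solution ∘ proj₁
  }
  where open Problem P

-- Polynomial-time many-one reducibility. Whether or not an instance of Q
-- has a solution can be read off from any answer to it, so for a decision
-- problem P this also reduces P to the search version of Q.
infix 4 _≤ₚ_

_≤ₚ_ : ∀ {i s j t} → Problem i s → Problem j t → Set (suc 0ℓ ⊔ i ⊔ s ⊔ j ⊔ t)
P ≤ₚ Q = Σ[ f ∈ (P.Instance → Q.Instance) ]
  PolynomialTime P.encode Q.encode f ×
  (∀ x → P.Solution x ⇔ Q.Solution (f x))
  where
  module P = Problem P
  module Q = Problem Q

unary : ℕ → Word
unary n = replicate n true ++ false ∷ []

-- Row-major listing of a square array.
listing : ∀ {n} → (Fin n → Fin n → Word) → Word
listing m = concat (List.tabulate λ i → concat (List.tabulate (m i)))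

------------------------------------------------------------------------
-- Graph isomorphism

record Graph : Set where
  field
    vertices    : ℕ
    adjacent    : Fin vertices → Fin vertices → Bool
    symmetric   : ∀ i j → adjacent i j ≡ adjacent j i
    irreflexive : ∀ i → adjacent i i ≡ false

encodeGraph : Graph → Word
encodeGraph G = unary vertices ++ listing (λ i j → adjacent i j ∷ [])
  where open Graph G

record _≅_ (G H : Graph) : Set where
  private
    module G = Graph G
    module H = Graph H
  field
    bijection : Fin G.vertices ↔ Fin H.vertices
  open Inverse bijection using (to)
  field
    preserves : ∀ i j → G.adjacent i j ≡ H.adjacent (to i) (to j)

GI : Problem 0ℓ 0ℓ
GI = record
  { Instance = Graph × Graph
  ; encode   = λ (G , H) → encodeGraph G ++ encodeGraph H
  ; Solution = λ (G , H) → G ≅ H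
  }

------------------------------------------------------------------------
-- Matrix Lie algebras

-- Classically a Heyting field is the same thing as a field: take x # y to
-- be ¬ (x ≈ y).
module _ {c ℓ₁ ℓ₂} (F : HeytingField c ℓ₁ ℓ₂) where

  open CommutativeRing
    (HeytingCommutativeRing.commutativeRing (HeytingField.heytingCommutativeRing F))
  open Summation +-commutativeMonoid using (sum)

  Matrix : ℕ → Set c
  Matrix n = Fin n → Fin n → Carrier

  MatrixSet : ℕ → Set (suc (c ⊔ ℓ₁))
  MatrixSet n = Matrix n → Set (c ⊔ ℓ₁)

  module _ {n : ℕ} where

    infix  4 _≋_
    infixl 6 _⊕_ _⊖_
    infixl 7 _⊗_ _·_

    _≋_ : Matrix n → Matrix n → Set ℓ₁
    A ≋ B = ∀ i j → A i j ≈ B i j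

    𝟙 𝟘 : Matrix n
    𝟙 i j = if does (i ≟ j) then 1# else 0#
    𝟘 i j = 0#

    _⊕_ _⊖_ _⊗_ ⁅_,_⁆ : Matrix n → Matrix n → Matrix n
    (A ⊕ B) i j = A i j + B i j
    (A ⊖ B) i j = A i j - B i j
    (A ⊗ B) i j = sum λ k → A i k * B k j
    ⁅ A , B ⁆   = A ⊗ B ⊖ B ⊗ A

    _·_ : Carrier → Matrix n → Matrix n
    (x · A) i j = x * A i j

    linearCombination : ∀ {d} → (Fin d → Carrier) → (Fin d → Matrix n) → Matrix n
    linearCombination x B i j = sum λ k → (x k · B k) i j

    Span : ∀ {d} → (Fin d → Matrix n) → MatrixSet n
    Span B M = ∃[ x ] M ≋ linearCombination x B

    LinearlyIndependent : ∀ {d} → (Fin d → Matrix n) → Set (c ⊔ ℓ₁)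
    LinearlyIndependent B = ∀ x → linearCombination x B ≋ 𝟘 → ∀ k → x k ≈ 0#

    record IsLieAlgebra (L : MatrixSet n) : Set (c ⊔ ℓ₁) where
      field
        respects  : ∀ {A B} → A ≋ B → L A → L B
        𝟘-closed  : L 𝟘
        ⊕-closed  : ∀ {A B} → L A → L B → L (A ⊕ B)
        ·-closed  : ∀ x {A} → L A → L (x · A)
        ⁅⁆-closed : ∀ {A B} → L A → L B → L ⁅ A , B ⁆

    Abelian : MatrixSet n → Set (c ⊔ ℓ₁)
    Abelian L = ∀ {A B} → L A → L B → A ⊗ B ≋ B ⊗ A

    IsDiagonal : Matrix n → Set ℓ₁
    IsDiagonal A = ∀ i j → i ≢ j → A i j ≈ 0#

    record IsInverse (A A⁻¹ : Matrix n) : Set ℓ₁ where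
      field
        inverseˡ : A⁻¹ ⊗ A ≋ 𝟙
        inverseʳ : A ⊗ A⁻¹ ≋ 𝟙

    Diagonalizable : MatrixSet n → Set (c ⊔ ℓ₁)
    Diagonalizable L = ∃[ A ] ∃[ A⁻¹ ] IsInverse A A⁻¹ ×
      (∀ {M} → L M → IsDiagonal (A ⊗ M ⊗ A⁻¹))

    record Conjugator (L₁ L₂ : MatrixSet n) : Set (c ⊔ ℓ₁) where
      field
        A A⁻¹     : Matrix n
        isInverse : IsInverse A A⁻¹
        conjugate : ∀ M → L₂ M ⇔ (∃[ N ] L₁ N × M ≋ A ⊗ N ⊗ A⁻¹)

  -- How the field elements occurring in instances are written down. Nothing
  -- is assumed about the chosen notation except that 0 and 1 can be written;
  -- elements may have several names or (as when F is uncountable) none.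
  record Notation : Set (c ⊔ ℓ₁) where
    field
      ⟦_⟧   : Word → Carrier
      zeroᴺ : ∃[ w ] ⟦ w ⟧ ≈ 0#
      oneᴺ  : ∃[ w ] ⟦ w ⟧ ≈ 1#

  module _ (N : Notation) where

    open Notation N

    record LieAlgebra (n : ℕ) : Set (c ⊔ ℓ₁) where
      field
        dimension : ℕ
        names     : Fin dimension → Fin n → Fin n → Word

      basis : Fin dimension → Matrix n
      basis k i j = ⟦ names k i j ⟧

      elements : MatrixSet n
      elements = Span basis

      field
        independent  : LinearlyIndependent basis
        isLieAlgebra : IsLieAlgebra elements

    -- Self-delimiting: every bit is preceded by `true`, the end is `false`.
    encodeName : Word → Word
    encodeName w = concatMap (λ b → true ∷ b ∷ []) w ++ false ∷ []

    encodeLieAlgebra : ∀ {n} → LieAlgebra n → Word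
    encodeLieAlgebra L =
      concat (List.tabulate λ k → true ∷ listing (λ i j → encodeName (names k i j)))
        ++ false ∷ []
      where open LieAlgebra L

    record LiePair : Set (c ⊔ ℓ₁) where
      field
        size  : ℕ
        L₁ L₂ : LieAlgebra size

    LAC : Problem (c ⊔ ℓ₁) (c ⊔ ℓ₁)
    LAC = record
      { Instance = LiePair
      ; encode   = λ P → let open LiePair P in
                     unary size ++ encodeLieAlgebra L₁ ++ encodeLieAlgebra L₂
      ; Solution = λ P → let open LiePair P in
                     Conjugator (LieAlgebra.elements L₁) (LieAlgebra.elements L₂)
      }

    AbelianDiagonalizable : LiePair → Set (c ⊔ ℓ₁)
    AbelianDiagonalizable P = good L₁ × good L₂
      where
      open LiePair P
      good : LieAlgebra size → Set (c ⊔ ℓ₁)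
      good L = Abelian (LieAlgebra.elements L) × Diagonalizable (LieAlgebra.elements L)

    abelianDiagonalizableLAC : Problem (c ⊔ ℓ₁) (c ⊔ ℓ₁)
    abelianDiagonalizableLAC = Restrict LAC AbelianDiagonalizable

{-# OPTIONS --safe #-}
module Submission where

-- The algebra of a graph on n vertices consists of diagonal matrices whose
-- n² + 1 diagonal entries are functionals on Fⁿ: e_u (once) for every vertex u,
-- e_u + e_v (twice) for every edge, and 0 otherwise. If A conjugates the algebra
-- of G to that of H, inducing g : Fⁿ → Fⁿ, then A i j ≠ 0 forces
-- (functional i of H) ∘ g = functional j of G. The functional e_v occurs only
-- once for G; it cannot come from an edge of H, since then two rows of A would be
-- supported in one column. Hence g permutes the coordinates, and the edges of H
-- correspond to those of G.
--
-- For the running time, programs over tapes with sequencing, branching and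
-- loops are compiled to machines. In row-major order a diagonal matrix of size
-- m + 1 is its first entry followed by blocks of m + 1 zeros and one further
-- diagonal entry, so the machine never compares matrix indices.

open import Defs hiding (_≋_; _⊗_; 𝟙; 𝟘; _·_; _⊕_; _⊖_; ⁅_,_⁆)
open import Algebra.Bundles using (CommutativeRing)
open import Algebra.Apartness.Bundles using (HeytingField; HeytingCommutativeRing)
import Algebra.Apartness.Properties.HeytingCommutativeRing as Apartness
import Algebra.Properties.CommutativeMonoid.Sum as Sum
import Algebra.Properties.Semiring.Sum as SemiringSum
import Algebra.Properties.Ring as RingProperties
import Relation.Binary.Reasoning.Setoid as SetoidReasoning
open import Data.Bool.Base using (Bool; true; false; if_then_else_)
open import Data.Fin.Base using (Fin; zero; suc)
open import Data.Fin.Permutation as Perm using (Permutation′; _⟨$⟩ʳ_; _⟨$⟩ˡ_)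
open import Data.Fin.Properties using (_≟_; suc-injective; 0≢1+n)
open import Data.Nat.Base using (ℕ; zero; suc)
open import Data.Product.Base using (∃-syntax; _×_; _,_; proj₁; proj₂)
open import Data.Sum.Base using (inj₁; inj₂)
open import Function.Base using (_∘_)
open import Function.Bundles using (_⇔_; mk⇔; Equivalence)
open import Relation.Binary.PropositionalEquality as ≡ using (_≡_; _≢_)
open import Relation.Nullary.Decidable.Core using (Dec; yes; no; does)
open import Relation.Nullary.Decidable using (dec-true; dec-false)
open import Relation.Nullary.Negation using (contradiction)

-- Over an arbitrary field a linear change of coordinates may turn `e_u` into `e_u + e_v`, so
-- arithmetic cannot tell a vertex functional from an edge functional. Multiplicity can: an edge is
-- listed at both `(u , v)` and `(v , u)`, a vertex only at `(u , u)`. Non-edges become further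
-- copies of 0, so that all n² pairs are treated alike. The additional index `zero` gives every
-- matrix a first entry followed by exactly one block for each pair. What the invertibility of A
-- provides is an invertible entry in each row and in each column, which matches every functional on
-- either side with one on the other. Equality in a Heyting field need not be decidable, so these
-- entries are not searched for but extracted from the fact that A A⁻¹ and A⁻¹ A have diagonal
-- entries 1.

module FieldLemmas {c ℓ₁ ℓ₂} (F : HeytingField c ℓ₁ ℓ₂) where

  open HeytingField F using (_#_; #-irrefl; #-cotrans; #⇒invertible; invertible⇒#; tight; heytingCommutativeRing)
  open CommutativeRing (HeytingCommutativeRing.commutativeRing heytingCommutativeRing) hiding (zero)
  open Apartness heytingCommutativeRing using (1#0; x-0≈x; #-congʳ; invertibleʳ⇒#)
  open Sum +-commutativeMonoid using (sum; sum-cong-≋; sum-permute; ∑-comm; ∑-distrib-+; sum-replicate-zero)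
  open SemiringSum semiring using (*-distribˡ-sum; *-distribʳ-sum)
  open RingProperties ring using (-0#≈0#)
  open SetoidReasoning setoid

  infix  4 _≋_
  infixl 7 _⊗_

  _≋_ : ∀ {n} → Matrix F n → Matrix F n → Set ℓ₁
  _≋_ = Defs._≋_ F

  _⊗_ : ∀ {n} → Matrix F n → Matrix F n → Matrix F n
  _⊗_ = Defs._⊗_ F

  𝟙 : ∀ {n} → Matrix F n
  𝟙 = Defs.𝟙 F

  -- Sums and apartness in a Heyting field.

  sum-zero : ∀ {n} (f : Fin n → Carrier) → (∀ k → f k ≈ 0#) → sum f ≈ 0#
  sum-zero {n} f f≈0 = trans (sum-cong-≋ f≈0) (sum-replicate-zero n)

  sum-single : ∀ {n} (f : Fin n → Carrier) i → (∀ k → k ≢ i → f k ≈ 0#) → sum f ≈ f i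
  sum-single f zero    f≈0 =
    trans (+-congˡ (sum-zero (f ∘ suc) λ k → f≈0 (suc k) (0≢1+n ∘ ≡.sym))) (+-identityʳ _)
  sum-single f (suc i) f≈0 =
    trans (+-cong (f≈0 zero 0≢1+n) (sum-single (f ∘ suc) i λ k k≢i → f≈0 (suc k) (k≢i ∘ suc-injective))) (+-identityˡ _)

  -- Cotransitivity compares the total with the sum of the tail: either they are apart, and then
  -- their difference, the first summand, is invertible, or the tail is apart from 0 and the search
  -- continues there.
  sum-#0 : ∀ {n} (f : Fin n → Carrier) → sum f # 0# → ∃[ k ] f k # 0#
  sum-#0 {zero}  f s#0 = contradiction s#0 (#-irrefl refl)
  sum-#0 {suc n} f s#0 with #-cotrans s#0 (sum (f ∘ suc))
  ... | inj₂ r#0 = let k , fₖ#0 = sum-#0 (f ∘ suc) r#0 in suc k , fₖ#0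
  ... | inj₁ s#r = zero , invertible⇒# (cast (#⇒invertible s#r))
    where
    s-r≈f₀ : sum f - sum (f ∘ suc) ≈ f zero - 0#
    s-r≈f₀ = begin
      f zero + sum (f ∘ suc) - sum (f ∘ suc)   ≈⟨ +-assoc _ _ _ ⟩
      f zero + (sum (f ∘ suc) - sum (f ∘ suc)) ≈⟨ +-congˡ (-‿inverseʳ _) ⟩
      f zero + 0#                              ≈⟨ +-congˡ -0#≈0# ⟨
      f zero - 0#                              ∎
    cast : (∃[ y ] y * (sum f - sum (f ∘ suc)) ≈ 1# × (sum f - sum (f ∘ suc)) * y ≈ 1#) →
           ∃[ y ] y * (f zero - 0#) ≈ 1# × (f zero - 0#) * y ≈ 1#
    cast (y , p , q) = y , trans (*-congˡ (sym s-r≈f₀)) p , trans (*-congʳ (sym s-r≈f₀)) q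

  -- An inverse of `x * y`, multiplied by `y`, is an inverse of `x`.
  *-#0ˡ : ∀ x y → x * y # 0# → x # 0#
  *-#0ˡ x y xy#0 with #⇒invertible xy#0
  ... | z , _ , xyz≈1 = invertibleʳ⇒# (y * z , (begin
    (x - 0#) * (y * z) ≈⟨ *-congʳ (x-0≈x x) ⟩
    x * (y * z)        ≈⟨ *-assoc x y z ⟨
    x * y * z          ≈⟨ *-congʳ (x-0≈x (x * y)) ⟨
    (x * y - 0#) * z   ≈⟨ xyz≈1 ⟩
    1#                 ∎))

  *-cancelˡ : ∀ {x y z} → x # 0# → x * y ≈ x * z → y ≈ z
  *-cancelˡ {x} {y} {z} x#0 xy≈xz with #⇒invertible x#0
  ... | w , wx≈1 , _ = begin
    y           ≈⟨ unscale y ⟨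
    w * (x * y) ≈⟨ *-congˡ xy≈xz ⟩
    w * (x * z) ≈⟨ unscale z ⟩
    z           ∎
    where
    unscale : ∀ y → w * (x * y) ≈ y
    unscale y = begin
      w * (x * y)      ≈⟨ *-assoc w x y ⟨
      w * x * y        ≈⟨ *-congʳ (*-congˡ (x-0≈x x)) ⟨
      w * (x - 0#) * y ≈⟨ *-congʳ wx≈1 ⟩
      1# * y           ≈⟨ *-identityˡ y ⟩
      y                ∎

  bit : Bool → Carrier
  bit b = if b then 1# else 0#

  -- Turns equations in the field into equations of Booleans. It rests on 1 being apart from 0, so
  -- it covers characteristic two.
  bit-injective : ∀ a b → bit a ≈ bit b → a ≡ b
  bit-injective true  true  e = ≡.refl
  bit-injective true  false e = contradiction 1#0 (#-irrefl e)
  bit-injective false true  e = contradiction 1#0 (#-irrefl (sym e))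
  bit-injective false false e = ≡.refl

  -- Matrix arithmetic and diagonal matrices.

  module _ {n : ℕ} where

    ⊗-diagˡ : (A B : Matrix F n) → IsDiagonal F A → ∀ i j → (A ⊗ B) i j ≈ A i i * B i j
    ⊗-diagˡ A B A-diag i j = sum-single _ i λ k k≢i →
      trans (*-congʳ (A-diag i k (k≢i ∘ ≡.sym))) (zeroˡ _)

    ⊗-diagʳ : (A B : Matrix F n) → IsDiagonal F B → ∀ i j → (A ⊗ B) i j ≈ A i j * B j j
    ⊗-diagʳ A B B-diag i j = sum-single _ j λ k k≢j → trans (*-congˡ (B-diag k j k≢j)) (zeroʳ _)

    diag-comm : (A B : Matrix F n) → IsDiagonal F A → IsDiagonal F B → A ⊗ B ≋ B ⊗ A
    diag-comm A B A-diag B-diag i j with i ≟ j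
    ... | yes ≡.refl = trans (⊗-diagˡ A B A-diag i i) (trans (*-comm _ _) (sym (⊗-diagˡ B A B-diag i i)))
    ... | no i≢j     = trans (vanish A B A-diag B-diag) (sym (vanish B A B-diag A-diag))
      where
      vanish : (A B : Matrix F n) → IsDiagonal F A → IsDiagonal F B → (A ⊗ B) i j ≈ 0#
      vanish A B A-diag B-diag = trans (⊗-diagˡ A B A-diag i j) (trans (*-congˡ (B-diag i j i≢j)) (zeroʳ _))

    𝟙-diag : IsDiagonal F {n} 𝟙
    𝟙-diag i j i≢j with i ≟ j
    ... | yes i≡j = contradiction i≡j i≢j
    ... | no _    = refl

    𝟙-ii : ∀ i → 𝟙 {n} i i ≈ 1#
    𝟙-ii i with i ≟ i
    ... | yes _  = refl
    ... | no i≢i = contradiction ≡.refl i≢i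

    ⊗-identityˡ : (A : Matrix F n) → 𝟙 ⊗ A ≋ A
    ⊗-identityˡ A i j = trans (⊗-diagˡ 𝟙 A 𝟙-diag i j) (trans (*-congʳ (𝟙-ii i)) (*-identityˡ _))

    ⊗-identityʳ : (A : Matrix F n) → A ⊗ 𝟙 ≋ A
    ⊗-identityʳ A i j = trans (⊗-diagʳ A 𝟙 𝟙-diag i j) (trans (*-congˡ (𝟙-ii j)) (*-identityʳ _))

    ⊗-cong : {A A′ B B′ : Matrix F n} → A ≋ A′ → B ≋ B′ → A ⊗ B ≋ A′ ⊗ B′
    ⊗-cong A≋A′ B≋B′ i j = sum-cong-≋ λ k → *-cong (A≋A′ i k) (B≋B′ k j)

    ⊗-assoc : (A B C : Matrix F n) → (A ⊗ B) ⊗ C ≋ A ⊗ (B ⊗ C)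
    ⊗-assoc A B C i j = begin
      (sum λ k → (sum λ l → A i l * B l k) * C k j)   ≈⟨ sum-cong-≋ (λ k → *-distribʳ-sum (C k j) (λ l → A i l * B l k)) ⟩
      (sum λ k → sum λ l → A i l * B l k * C k j)     ≈⟨ ∑-comm (λ k l → A i l * B l k * C k j) ⟩
      (sum λ l → sum λ k → A i l * B l k * C k j)     ≈⟨ sum-cong-≋ (λ l → sum-cong-≋ λ k → *-assoc (A i l) (B l k) (C k j)) ⟩
      (sum λ l → sum λ k → A i l * (B l k * C k j))   ≈⟨ sum-cong-≋ (λ l → *-distribˡ-sum (A i l) (λ k → B l k * C k j)) ⟨
      (sum λ l → A i l * (sum λ k → B l k * C k j))   ∎

  -- Lie algebras spanned by diagonal matrices.

  module _ {d n : ℕ} (B : Fin d → Matrix F n) (B-diag : ∀ k → IsDiagonal F (B k)) where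

    private
      lin : (Fin d → Carrier) → Matrix F n
      lin x = linearCombination F x B

    lin-diag : ∀ x → IsDiagonal F (lin x)
    lin-diag x i j i≢j = sum-zero _ λ k → trans (*-congˡ (B-diag k i j i≢j)) (zeroʳ _)

    span-diag : ∀ {M} → Span F B M → IsDiagonal F M
    span-diag (x , M≋) i j i≢j = trans (M≋ i j) (lin-diag x i j i≢j)

    span-abelian : Abelian F (Span F B)
    span-abelian {M} {M′} M∈ M′∈ = diag-comm M M′ (span-diag M∈) (span-diag M′∈)

    span-isLieAlgebra : IsLieAlgebra F (Span F B)
    span-isLieAlgebra = record
      { respects  = λ M≋M′ (x , M≋) → x , λ i j → trans (sym (M≋M′ i j)) (M≋ i j)
      ; 𝟘-closed  = (λ _ → 0#) , λ i j → sym (0-lin i j)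
      ; ⊕-closed  = λ (x , M≋) (y , M′≋) → (λ k → x k + y k) , λ i j → begin
          _                                    ≈⟨ +-cong (M≋ i j) (M′≋ i j) ⟩
          lin x i j + lin y i j                ≈⟨ ∑-distrib-+ (λ k → x k * B k i j) (λ k → y k * B k i j) ⟨
          (sum λ k → x k * B k i j + y k * B k i j) ≈⟨ sum-cong-≋ (λ k → distribʳ (B k i j) (x k) (y k)) ⟨
          lin (λ k → x k + y k) i j            ∎
      ; ·-closed  = λ c (x , M≋) → (λ k → c * x k) , λ i j → begin
          _                                    ≈⟨ *-congˡ (M≋ i j) ⟩
          c * lin x i j                        ≈⟨ *-distribˡ-sum c (λ k → x k * B k i j) ⟩
          (sum λ k → c * (x k * B k i j))      ≈⟨ sum-cong-≋ (λ k → *-assoc c (x k) (B k i j)) ⟨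
          lin (λ k → c * x k) i j              ∎
      -- Diagonal matrices commute, so the bracket is 0 and gets zero coefficients.
      ; ⁅⁆-closed = λ M∈ M′∈ → (λ _ → 0#) , λ i j →
          trans (+-congʳ (span-abelian M∈ M′∈ i j)) (trans (-‿inverseʳ _) (sym (0-lin i j)))
      }
      where
      0-lin : ∀ i j → lin (λ _ → 0#) i j ≈ 0#
      0-lin i j = sum-zero _ λ k → zeroˡ (B k i j)

    span-diagonalizable : Diagonalizable F (Span F B)
    span-diagonalizable = 𝟙 , 𝟙 , record { inverseˡ = ⊗-identityˡ 𝟙 ; inverseʳ = ⊗-identityˡ 𝟙 } , λ {M} M∈ i j i≢j →
      trans (⊗-identityʳ (𝟙 ⊗ M) i j) (trans (⊗-identityˡ M i j) (span-diag M∈ i j i≢j))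

  -- Conjugation by permutation matrices.

  module _ {n : ℕ} (ρ : Permutation′ n) where

    private
      P P⁻¹ : Matrix F n
      P   i j = 𝟙 i (ρ ⟨$⟩ʳ j)
      P⁻¹ i j = 𝟙 (ρ ⟨$⟩ʳ i) j

      P-⊗ : ∀ M i j → (P ⊗ M) i j ≈ M (ρ ⟨$⟩ˡ i) j
      P-⊗ M i j = begin
        (P ⊗ M) i j                                           ≈⟨ sum-single _ (ρ ⟨$⟩ˡ i) (λ k k≢ →
          trans (*-congʳ (𝟙-diag i (ρ ⟨$⟩ʳ k) λ i≡ρk → k≢ (≡.trans (≡.sym (Perm.inverseˡ ρ)) (≡.cong (ρ ⟨$⟩ˡ_) (≡.sym i≡ρk))))) (zeroˡ _)) ⟩
        𝟙 i (ρ ⟨$⟩ʳ (ρ ⟨$⟩ˡ i)) * M (ρ ⟨$⟩ˡ i) j              ≡⟨ ≡.cong (λ l → 𝟙 i l * M (ρ ⟨$⟩ˡ i) j) (Perm.inverseʳ ρ) ⟩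
        𝟙 i i * M (ρ ⟨$⟩ˡ i) j                                ≈⟨ *-congʳ (𝟙-ii i) ⟩
        1# * M (ρ ⟨$⟩ˡ i) j                                   ≈⟨ *-identityˡ _ ⟩
        M (ρ ⟨$⟩ˡ i) j                                        ∎

      ⊗-P⁻¹ : ∀ M i j → (M ⊗ P⁻¹) i j ≈ M i (ρ ⟨$⟩ˡ j)
      ⊗-P⁻¹ M i j = begin
        (M ⊗ P⁻¹) i j                                         ≈⟨ sum-single _ (ρ ⟨$⟩ˡ j) (λ k k≢ →
          trans (*-congˡ (𝟙-diag (ρ ⟨$⟩ʳ k) j λ ρk≡j → k≢ (≡.trans (≡.sym (Perm.inverseˡ ρ)) (≡.cong (ρ ⟨$⟩ˡ_) ρk≡j)))) (zeroʳ _)) ⟩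
        M i (ρ ⟨$⟩ˡ j) * 𝟙 (ρ ⟨$⟩ʳ (ρ ⟨$⟩ˡ j)) j              ≡⟨ ≡.cong (λ l → M i (ρ ⟨$⟩ˡ j) * 𝟙 l j) (Perm.inverseʳ ρ) ⟩
        M i (ρ ⟨$⟩ˡ j) * 𝟙 j j                                ≈⟨ *-congˡ (𝟙-ii j) ⟩
        M i (ρ ⟨$⟩ˡ j) * 1#                                   ≈⟨ *-identityʳ _ ⟩
        M i (ρ ⟨$⟩ˡ j)                                        ∎

      conjugate-P : ∀ M i j → (P ⊗ M ⊗ P⁻¹) i j ≈ M (ρ ⟨$⟩ˡ i) (ρ ⟨$⟩ˡ j)
      conjugate-P M i j = trans (⊗-P⁻¹ (P ⊗ M) i j) (P-⊗ M i (ρ ⟨$⟩ˡ j))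

      P-isInverse : IsInverse F P P⁻¹
      P-isInverse = record
        -- Entry `(i , j)` of `P⁻¹ ⊗ P` is by definition the entry of `𝟙 ⊗ 𝟙` at the images of `i`
        -- and `j` under `ρ`.
        { inverseˡ = λ i j → trans (⊗-identityˡ 𝟙 (ρ ⟨$⟩ʳ i) (ρ ⟨$⟩ʳ j)) (𝟙-ρ i j)
        ; inverseʳ = λ i j → trans (P-⊗ P⁻¹ i j) (reflexive (≡.cong (λ l → 𝟙 l j) (Perm.inverseʳ ρ)))
        }
        where
        𝟙-ρ : ∀ i j → 𝟙 (ρ ⟨$⟩ʳ i) (ρ ⟨$⟩ʳ j) ≈ 𝟙 i j
        𝟙-ρ i j with i ≟ j
        ... | yes ≡.refl = 𝟙-ii (ρ ⟨$⟩ʳ i)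
        ... | no i≢j     = 𝟙-diag _ _ λ e → i≢j (≡.trans (≡.sym (Perm.inverseˡ ρ)) (≡.trans (≡.cong (ρ ⟨$⟩ˡ_) e) (Perm.inverseˡ ρ)))

    -- Conjugating by the permutation matrix moves the positions by `ρ`; relabelling the
    -- coefficients along `π` compensates for the different order of the two bases.
    permutation-conjugator : ∀ {d} (π : Permutation′ d) (B B′ : Fin d → Matrix F n) →
      (∀ k i j → B′ (π ⟨$⟩ʳ k) i j ≈ B k (ρ ⟨$⟩ˡ i) (ρ ⟨$⟩ˡ j)) →
      Conjugator F (Span F B) (Span F B′)
    permutation-conjugator π B B′ B′≈B = record
      { A = P ; A⁻¹ = P⁻¹ ; isInverse = P-isInverse ; conjugate = λ M → mk⇔
        (λ (y , M≋) → linearCombination F (y ∘ (π ⟨$⟩ʳ_)) B , (_ , λ i j → refl) , λ i j → begin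
          M i j                                                  ≈⟨ M≋ i j ⟩
          linearCombination F y B′ i j                           ≈⟨ relabel y i j ⟩
          linearCombination F (y ∘ (π ⟨$⟩ʳ_)) B (ρ ⟨$⟩ˡ i) (ρ ⟨$⟩ˡ j)
                                                                 ≈⟨ conjugate-P (linearCombination F (y ∘ (π ⟨$⟩ʳ_)) B) i j ⟨
          _                                                      ∎)
        (λ (L , (x , L≋) , M≋) → x ∘ (π ⟨$⟩ˡ_) , λ i j → begin
          M i j                                                  ≈⟨ M≋ i j ⟩
          (P ⊗ L ⊗ P⁻¹) i j                                      ≈⟨ conjugate-P L i j ⟩
          -- After this, `π` followed by its inverse is inserted in the coefficients, to reach the
          -- form that `relabel` expects.
          L (ρ ⟨$⟩ˡ i) (ρ ⟨$⟩ˡ j)                                ≈⟨ L≋ _ _ ⟩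
          linearCombination F x B (ρ ⟨$⟩ˡ i) (ρ ⟨$⟩ˡ j)          ≈⟨ sum-cong-≋ (λ k → *-congʳ {B k (ρ ⟨$⟩ˡ i) (ρ ⟨$⟩ˡ j)} (reflexive (≡.cong x (≡.sym (Perm.inverseˡ π {k}))))) ⟩
          linearCombination F (x ∘ (π ⟨$⟩ˡ_) ∘ (π ⟨$⟩ʳ_)) B (ρ ⟨$⟩ˡ i) (ρ ⟨$⟩ˡ j)
                                                                 ≈⟨ relabel (x ∘ (π ⟨$⟩ˡ_)) i j ⟨
          linearCombination F (x ∘ (π ⟨$⟩ˡ_)) B′ i j             ∎)
      }
      where
      relabel : ∀ y i j → linearCombination F y B′ i j ≈
                linearCombination F (y ∘ (π ⟨$⟩ʳ_)) B (ρ ⟨$⟩ˡ i) (ρ ⟨$⟩ˡ j)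
      relabel y i j = trans (sum-permute (λ k → y k * B′ k i j) π) (sum-cong-≋ λ k → *-congˡ (B′≈B k i j))

  -- Codes: the rows of χ generate a space of diagonal matrices.

  Code : ℕ → ℕ → Set
  Code d n = Fin d → Fin n → Bool

  -- Column `i` of `χ` read as a linear functional and evaluated at `x`; for matrices spanned by `χ`
  -- it is the `i`-th diagonal entry of a combination.
  weight : ∀ {d n} → Code d n → (Fin d → Carrier) → Fin n → Carrier
  weight χ x i = sum λ k → x k * bit (χ k i)

  -- `y k` lists the coordinates of the image of the `k`-th basis vector. So the `i`-th functional
  -- of `χ′`, pulled back along `y`, is the `j`-th functional of `χ`, tested on a basis.
  Matched : ∀ {d n} → Code d n → Code d n → (Fin d → Fin d → Carrier) → Fin n → Fin n → Set ℓ₁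
  Matched χ χ′ y i j = ∀ k → weight χ′ (y k) i ≈ bit (χ k j)

  -- Multiplicity one, the property that separates vertices from edges.
  Simple : ∀ {d n} → Code d n → Fin n → Set
  Simple χ j = ∀ j′ → (∀ k → χ k j′ ≡ χ k j) → j′ ≡ j

  record Spans {d n} (B : Fin d → Matrix F n) (χ : Code d n) : Set ℓ₁ where
    field
      onDiagonal  : ∀ k i → B k i i ≈ bit (χ k i)
      offDiagonal : ∀ k → IsDiagonal F (B k)

  weight-single : ∀ {d n} (χ : Code d n) x i k → (∀ l → χ l i ≡ does (l ≟ k)) → weight χ x i ≈ x k
  weight-single χ x i k pivot = begin
    weight χ x i      ≈⟨ sum-single _ k (λ l l≢k → trans (*-congˡ (reflexive (≡.cong bit (≡.trans (pivot l) (dec-false (l ≟ k) l≢k))))) (zeroʳ _)) ⟩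
    x k * bit (χ k i) ≡⟨ ≡.cong (λ b → x k * bit b) (≡.trans (pivot k) (dec-true (k ≟ k) ≡.refl)) ⟩
    x k * 1#          ≈⟨ *-identityʳ _ ⟩
    x k               ∎

  module _ {d n} {B : Fin d → Matrix F n} {χ : Code d n} (B-spans : Spans B χ) where
    open Spans B-spans

    lin-weight : ∀ x i → linearCombination F x B i i ≈ weight χ x i
    lin-weight x i = sum-cong-≋ λ k → *-congˡ (onDiagonal k i)

    -- At the pivot of `k` the diagonal entry of a combination is its `k`-th coefficient.
    pivots⇒independent : (pivot : Fin d → Fin n) → (∀ k l → χ l (pivot k) ≡ does (l ≟ k)) → LinearlyIndependent F B
    pivots⇒independent pivot isPivot x x≋𝟘 k = begin
      x k                                           ≈⟨ weight-single χ x (pivot k) k (isPivot k) ⟨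
      weight χ x (pivot k)                          ≈⟨ lin-weight x (pivot k) ⟨
      linearCombination F x B (pivot k) (pivot k)   ≈⟨ x≋𝟘 _ _ ⟩
      0#                                            ∎

  -- If A ℒ A⁻¹ = ℒ′ then wherever A i j is invertible, the i-th weight of ℒ′
  -- composed with the isomorphism is the j-th weight of ℒ.
  module _ {d n} {B B′ : Fin d → Matrix F n} {χ χ′ : Code d n} (B-spans : Spans B χ) (B′-spans : Spans B′ χ′)
           (C : Conjugator F (Span F B) (Span F B′)) where

    open Conjugator C
    open IsInverse isInverse
    private
      module S = Spans B-spans
      module S′ = Spans B′-spans

      image : ∀ k → Span F B′ (A ⊗ B k ⊗ A⁻¹)
      image k = Equivalence.from (conjugate (A ⊗ B k ⊗ A⁻¹)) (B k , B∈ , λ _ _ → refl)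
        where
        B∈ : Span F B (B k)
        B∈ = (λ l → bit (does (l ≟ k))) , λ i j → sym (begin
          (sum λ l → bit (does (l ≟ k)) * B l i j) ≈⟨ sum-single _ k (λ l l≢k → trans (*-congʳ (reflexive (≡.cong bit (dec-false (l ≟ k) l≢k)))) (zeroˡ _)) ⟩
          bit (does (k ≟ k)) * B k i j              ≡⟨ ≡.cong (λ b → bit b * B k i j) (dec-true (k ≟ k) ≡.refl) ⟩
          1# * B k i j                              ≈⟨ *-identityˡ _ ⟩
          B k i j                                   ∎)

    -- The matrix of the map induced by conjugation, relative to the two bases.
    coordinates : Fin d → Fin d → Carrier
    coordinates k = proj₁ (image k)

    private
      _∼_ = Matched χ χ′ coordinates
      -- Both sides are entry `(i , j)` of `A ⊗ B k`: once the diagonal matrix `B k` scales the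
      -- columns of `A`, and once, after rewriting as `(A ⊗ B k ⊗ A⁻¹) ⊗ A`, a diagonal matrix
      -- scales its rows.
      intertwine : ∀ k i j → A i j * weight χ′ (coordinates k) i ≈ A i j * bit (χ k j)
      intertwine k i j = sym (begin
        A i j * bit (χ k j)                                    ≈⟨ *-congˡ (S.onDiagonal k j) ⟨
        A i j * B k j j                                        ≈⟨ ⊗-diagʳ A (B k) (S.offDiagonal k) i j ⟨
        (A ⊗ B k) i j                                          ≈⟨ ⊗-identityʳ (A ⊗ B k) i j ⟨
        ((A ⊗ B k) ⊗ 𝟙) i j                                    ≈⟨ ⊗-cong {A = A ⊗ B k} (λ _ _ → refl) inverseˡ i j ⟨
        ((A ⊗ B k) ⊗ (A⁻¹ ⊗ A)) i j                            ≈⟨ ⊗-assoc (A ⊗ B k) A⁻¹ A i j ⟨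
        ((A ⊗ B k ⊗ A⁻¹) ⊗ A) i j                              ≈⟨ ⊗-cong {B = A} (proj₂ (image k)) (λ _ _ → refl) i j ⟩
        (linearCombination F (coordinates k) B′ ⊗ A) i j       ≈⟨ ⊗-diagˡ _ A (lin-diag B′ S′.offDiagonal (coordinates k)) i j ⟩
        linearCombination F (coordinates k) B′ i i * A i j     ≈⟨ *-congʳ (lin-weight B′-spans (coordinates k) i) ⟩
        weight χ′ (coordinates k) i * A i j                    ≈⟨ *-comm _ _ ⟩
        A i j * weight χ′ (coordinates k) i                    ∎)

      #0⇒matched : ∀ {i j} → A i j # 0# → i ∼ j
      #0⇒matched {i} {j} Aᵢⱼ#0 k = *-cancelˡ Aᵢⱼ#0 (intertwine k i j)

      -- One of the products `A i j * A⁻¹ j i` is apart from 0 because they add up to 1; with it,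
      -- its first factor is.
      rowEntry : ∀ i → ∃[ j ] A i j # 0#
      rowEntry i =
        let j , #0 = sum-#0 _ (#-congʳ (sym (trans (inverseʳ i i) (𝟙-ii i))) 1#0)
        in j , *-#0ˡ _ _ #0

      columnEntry : ∀ j → ∃[ i ] A i j # 0#
      columnEntry j =
        let i , #0 = sum-#0 _ (#-congʳ (sym (trans (inverseˡ j j) (𝟙-ii j))) 1#0)
        in i , *-#0ˡ _ _ (#-congʳ (*-comm _ _) #0)

    row-matched : ∀ i → ∃[ j ] i ∼ j
    row-matched i = let j , #0 = rowEntry i in j , #0⇒matched #0

    column-matched : ∀ j → ∃[ i ] i ∼ j
    column-matched j = let i , #0 = columnEntry j in i , #0⇒matched #0

    -- Two rows of A supported in the same single column would be linearly dependent.
    column-matched-simple : ∀ j → Simple χ j → ∃[ i ] i ∼ j × Simple χ′ i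
    column-matched-simple j simple = i , matched , λ i′ same → decide i′ same (i′ ≟ i)
      where
      i       = proj₁ (columnEntry j)
      Aᵢⱼ#0   = proj₂ (columnEntry j)
      matched = #0⇒matched Aᵢⱼ#0

      decide : ∀ i′ → (∀ k → χ′ k i′ ≡ χ′ k i) → Dec (i′ ≡ i) → i′ ≡ i
      decide i′ same (yes i′≡i) = i′≡i
      decide i′ same (no i′≢i)  = contradiction 1#0 (#-irrefl (begin
        1#                     ≈⟨ trans (inverseʳ i′ i′) (𝟙-ii i′) ⟨
        (A ⊗ A⁻¹) i′ i′        ≈⟨ supported i′ i′ matched′ ⟩
        A i′ j * A⁻¹ j i′      ≈⟨ *-congˡ A⁻¹ⱼᵢ′≈0 ⟩
        A i′ j * 0#            ≈⟨ zeroʳ _ ⟩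
        0#                     ∎))
        where
        -- Equal columns of `χ′` are the same functional, so row `i′` is matched with `j` too.
        matched′ : i′ ∼ j
        matched′ k = trans (sum-cong-≋ λ l → *-congˡ (reflexive (≡.cong bit (same l)))) (matched k)

        -- By simplicity no entry outside column `j` is apart from 0; tightness makes it equal to 0.
        supported : ∀ i₁ i₂ → i₁ ∼ j → (A ⊗ A⁻¹) i₁ i₂ ≈ A i₁ j * A⁻¹ j i₂
        supported i₁ i₂ m = sum-single _ j λ j′ j′≢j → trans (*-congʳ
          (proj₁ (tight _ _) λ #0 → j′≢j (simple j′ λ k → bit-injective _ _ (trans (sym (#0⇒matched #0 k)) (m k))))) (zeroˡ _)

        -- Entry `(i , i′)` of `A ⊗ A⁻¹` is 0 and reduces to one product, whose first factor is
        -- invertible.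
        A⁻¹ⱼᵢ′≈0 : A⁻¹ j i′ ≈ 0#
        A⁻¹ⱼᵢ′≈0 = *-cancelˡ Aᵢⱼ#0 (begin
          A i j * A⁻¹ j i′  ≈⟨ supported i i′ matched ⟨
          (A ⊗ A⁻¹) i i′    ≈⟨ inverseʳ i i′ ⟩
          𝟙 i i′            ≈⟨ 𝟙-diag i i′ (i′≢i ∘ ≡.sym) ⟩
          0#                ≈⟨ zeroʳ _ ⟨
          A i j * 0#        ∎)

-- Structured programs

open import Data.Bool.Base using (not; _∧_; _∨_)
open import Data.Fin.Base using (toℕ; remQuot; combine; _↑ˡ_; _↑ʳ_)
open import Data.Fin.Patterns using (0F; 1F; 2F; 3F; 4F; 5F)
open import Data.Fin.Permutation using (lift₀)
open import Data.Fin.Properties using (+↔⊎; 1↔⊤; *↔×; remQuot-combine; combine-remQuot; combine-injective; splitAt-↑ˡ; splitAt-↑ʳ; pigeonhole; any?; <⇒≢)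
open import Data.List.Base as List using (List; []; _∷_; [_]; _++_; _ʳ++_; length; replicate; concat; tabulate; map)
open import Data.List.Properties using (++-ʳ++; ʳ++-ʳ++; ++-identityʳ; ++-assoc; length-replicate; length-tabulate; length-++; length-ʳ++; length-map; tabulate-cong)
open import Data.Maybe.Base as Maybe using (Maybe; just; nothing; maybe′; is-just)
open import Data.Nat.Base using (_+_; _*_; _^_; _≤_; z≤n; s≤s)
open import Data.Nat.Properties as ℕ using (m≤m+n; m≤n+m; +-suc; +-comm; +-identityʳ)
open import Data.Nat.Tactic.RingSolver using (solve-∀)
open import Data.Product.Base using (∃₂)
open import Data.Product.Function.NonDependent.Propositional using (_×-↔_)
open import Data.Sum.Base using (_⊎_)
open import Data.Sum.Function.Propositional using (_⊎-↔_)
open import Data.Unit.Base using (⊤; tt)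
open import Data.Vec.Base as Vec using (Vec; []; _∷_; lookup; _[_]≔_; _[_]%=_)
open import Data.Vec.Properties using (lookup∘updateAt; lookup-zipWith; map-[]≔)
open import Function.Base using (id)
open import Function.Bundles using (_↔_; mk↔ₛ′)
open import Function.Properties.Inverse using (↔-sym; ↔-trans)
open import Relation.Binary.PropositionalEquality using (refl; sym; trans; cong; cong₂; subst; module ≡-Reasoning)
open import Relation.Nullary.Decidable using (does-⇔)
open import Relation.Nullary.Negation using (¬_)

Heads Tapes Action : ℕ → Set
Heads k  = Vec Symbol k
Tapes k  = Vec Tape k
Action k = Vec (Symbol × Move) k

heads : ∀ {k} → Tapes k → Heads k
heads = Vec.map head

apply : ∀ {k} → Action k → Tapes k → Tapes k
apply = Vec.zipWith act

keep : ∀ {k} → Heads k → Action k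
keep = Vec.map (_, stay)

apply-keep : ∀ {k} (ts : Tapes k) → apply (keep (heads ts)) ts ≡ ts
apply-keep []       = refl
apply-keep (t ∷ ts) = cong (t ∷_) (apply-keep ts)

infixr 4 _⊎-finite_

_⊎-finite_ : ∀ {A B : Set} {m n} → A ↔ Fin m → B ↔ Fin n → (A ⊎ B) ↔ Fin (m + n)
A↔m ⊎-finite B↔n = ↔-trans (A↔m ⊎-↔ B↔n) (↔-sym +↔⊎)

⊤-finite : ⊤ ↔ Fin 1
⊤-finite = ↔-sym 1↔⊤

infixr 5 _⨾_

-- Tests see all heads but an action changes a single tape, so effects can be stated tape by tape.
data Program (k : ℕ) : Set where
  at    : Fin k → (Symbol → Symbol × Move) → Program k
  _⨾_   : Program k → Program k → Program k
  when  : (Heads k → Bool) → Program k → Program k → Program k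
  while : (Heads k → Bool) → Program k → Program k

-- Every state performs one action and then either names its successor or,
-- with `nothing`, leaves the program.
module _ {k : ℕ} where

  Control : Program k → Set
  Control (at x g)     = ⊤
  Control (P ⨾ Q)      = Control P ⊎ Control Q
  Control (when c P Q) = ⊤ ⊎ (Control P ⊎ Control Q)
  Control (while c P)  = ⊤ ⊎ Control P

  controlSize : Program k → ℕ
  controlSize (at x g)     = 1
  controlSize (P ⨾ Q)      = controlSize P + controlSize Q
  controlSize (when c P Q) = 1 + (controlSize P + controlSize Q)
  controlSize (while c P)  = 1 + controlSize P

  control-finite : ∀ P → Control P ↔ Fin (controlSize P)
  control-finite (at x g)     = ⊤-finite
  control-finite (P ⨾ Q)      = control-finite P ⊎-finite control-finite Q
  control-finite (when c P Q) = ⊤-finite ⊎-finite control-finite P ⊎-finite control-finite Q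
  control-finite (while c P)  = ⊤-finite ⊎-finite control-finite P

  entry : ∀ P → Control P
  entry (at x g)     = tt
  entry (P ⨾ Q)      = inj₁ (entry P)
  entry (when c P Q) = inj₁ tt
  entry (while c P)  = inj₁ tt

  transit : ∀ P → Control P → Heads k → Action k × Maybe (Control P)
  transit (at x g)     tt              h = keep h [ x ]%= (g ∘ proj₁) , nothing
  transit (P ⨾ Q)      (inj₁ p)        h with transit P p h
  -- Leaving `P` leads straight to the entry of `Q`, so composition costs no step of its own.
  ... | a , p′ = a , just (maybe′ inj₁ (inj₂ (entry Q)) p′)
  transit (P ⨾ Q)      (inj₂ q)        h with transit Q q h
  ... | a , q′ = a , Maybe.map inj₂ q′
  transit (when c P Q) (inj₁ tt)       h =
    -- Testing takes a step of its own, in which every scanned symbol is rewritten unchanged.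
    keep h , just (if c h then inj₂ (inj₁ (entry P)) else inj₂ (inj₂ (entry Q)))
  transit (when c P Q) (inj₂ (inj₁ p)) h with transit P p h
  ... | a , p′ = a , Maybe.map (inj₂ ∘ inj₁) p′
  transit (when c P Q) (inj₂ (inj₂ q)) h with transit Q q h
  ... | a , q′ = a , Maybe.map (inj₂ ∘ inj₂) q′
  transit (while c P)  (inj₁ tt)       h =
    keep h , (if c h then just (inj₂ (entry P)) else nothing)
  transit (while c P)  (inj₂ p)        h with transit P p h
  ... | a , p′ = a , just (maybe′ inj₂ (inj₁ tt) p′)

  -- Runs P p ts t us : from state p of P and tapes ts the program P is left
  -- with tapes us after at most t steps.
  data Runs (P : Program k) (p : Control P) (ts : Tapes k) : ℕ → Tapes k → Set where
    leave : ∀ {t a} → transit P p (heads ts) ≡ (a , nothing) →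
            Runs P p ts (suc t) (apply a ts)
    enter : ∀ {t a p′ us} → transit P p (heads ts) ≡ (a , just p′) →
            Runs P p′ (apply a ts) t us → Runs P p ts (suc t) us

  infix 3 _⊢_⇒[_]_

  _⊢_⇒[_]_ : Program k → Tapes k → ℕ → Tapes k → Set
  P ⊢ ts ⇒[ t ] us = Runs P (entry P) ts t us

  weaken : ∀ {P p ts t t′ us} → t ≤ t′ → Runs P p ts t us → Runs P p ts t′ us
  weaken (s≤s t≤t′) (leave e)   = leave e
  weaken (s≤s t≤t′) (enter e r) = enter e (weaken t≤t′ r)

  module _ {P Q : Program k} where

    private
      runs-second : ∀ {q ts t us} → Runs Q q ts t us → Runs (P ⨾ Q) (inj₂ q) ts t us
      runs-second (leave e)   = leave (cong (λ (a , q) → a , Maybe.map inj₂ q) e)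
      runs-second (enter e r) =
        enter (cong (λ (a , q) → a , Maybe.map inj₂ q) e) (runs-second r)

      runs-first : ∀ {p ts t us t′ vs} → Runs P p ts t us → Q ⊢ us ⇒[ t′ ] vs →
                   Runs (P ⨾ Q) (inj₁ p) ts (t + t′) vs
      runs-first (leave {t = t} e) s =
        enter (cong (λ (a , p) → a , just (maybe′ inj₁ (inj₂ (entry Q)) p)) e)
              (weaken (m≤n+m _ t) (runs-second s))
      runs-first (enter e r) s =
        enter (cong (λ (a , p) → a , just (maybe′ inj₁ (inj₂ (entry Q)) p)) e)
              (runs-first r s)

    infixr 5 _then_

    _then_ : ∀ {ts t us t′ vs} → P ⊢ ts ⇒[ t ] us → Q ⊢ us ⇒[ t′ ] vs →
             P ⨾ Q ⊢ ts ⇒[ t + t′ ] vs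
    _then_ = runs-first

  module _ {c : Heads k → Bool} {P Q : Program k} where

    private
      runs-true : ∀ {p ts t us} → Runs P p ts t us → Runs (when c P Q) (inj₂ (inj₁ p)) ts t us
      runs-true (leave e)   = leave (cong (λ (a , p) → a , Maybe.map (inj₂ ∘ inj₁) p) e)
      runs-true (enter e r) =
        enter (cong (λ (a , p) → a , Maybe.map (inj₂ ∘ inj₁) p) e) (runs-true r)

      runs-false : ∀ {q ts t us} → Runs Q q ts t us → Runs (when c P Q) (inj₂ (inj₂ q)) ts t us
      runs-false (leave e)   = leave (cong (λ (a , q) → a , Maybe.map (inj₂ ∘ inj₂) q) e)
      runs-false (enter e r) =
        enter (cong (λ (a , q) → a , Maybe.map (inj₂ ∘ inj₂) q) e) (runs-false r)

    when-true : ∀ {ts t us} → c (heads ts) ≡ true → P ⊢ ts ⇒[ t ] us →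
                when c P Q ⊢ ts ⇒[ suc t ] us
    when-true {ts} e r =
      enter (cong (λ b → keep (heads ts) , just (if b then inj₂ (inj₁ (entry P)) else inj₂ (inj₂ (entry Q)))) e)
            (subst (λ ts → Runs _ _ ts _ _) (sym (apply-keep ts)) (runs-true r))

    when-false : ∀ {ts t us} → c (heads ts) ≡ false → Q ⊢ ts ⇒[ t ] us →
                 when c P Q ⊢ ts ⇒[ suc t ] us
    when-false {ts} e r =
      enter (cong (λ b → keep (heads ts) , just (if b then inj₂ (inj₁ (entry P)) else inj₂ (inj₂ (entry Q)))) e)
            (subst (λ ts → Runs _ _ ts _ _) (sym (apply-keep ts)) (runs-false r))

  module _ {c : Heads k → Bool} {P : Program k} where

    private
      runs-body : ∀ {p ts t us t′ vs} → Runs P p ts t us → while c P ⊢ us ⇒[ t′ ] vs →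
                  Runs (while c P) (inj₂ p) ts (t + t′) vs
      runs-body (leave {t = t} e) s =
        enter (cong (λ (a , p) → a , just (maybe′ inj₂ (inj₁ tt) p)) e)
              (weaken (m≤n+m _ t) s)
      runs-body (enter e r) s =
        enter (cong (λ (a , p) → a , just (maybe′ inj₂ (inj₁ tt) p)) e) (runs-body r s)

    while-done : ∀ {ts} → c (heads ts) ≡ false → while c P ⊢ ts ⇒[ 1 ] ts
    while-done {ts} e =
      subst (Runs (while c P) (inj₁ tt) ts 1) (apply-keep ts)
        (leave (cong (λ b → keep (heads ts) , (if b then just (inj₂ (entry P)) else nothing)) e))

    while-next : ∀ {ts t us t′ vs} → c (heads ts) ≡ true → P ⊢ ts ⇒[ t ] us →
                 while c P ⊢ us ⇒[ t′ ] vs → while c P ⊢ ts ⇒[ suc (t + t′) ] vs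
    while-next {ts} e r s =
      enter (cong (λ b → keep (heads ts) , (if b then just (inj₂ (entry P)) else nothing)) e)
            (subst (λ ts → Runs _ _ ts _ _) (sym (apply-keep ts)) (runs-body r s))

  lookup-heads : ∀ (ts : Tapes k) x t → lookup (heads (ts [ x ]≔ t)) x ≡ head t
  lookup-heads ts x t = trans (cong (λ h → lookup h x) (map-[]≔ head ts x)) (lookup∘updateAt x (heads ts))

apply-at : ∀ {k} (ts : Tapes k) x g t →
           apply (keep (heads (ts [ x ]≔ t)) [ x ]%= (g ∘ proj₁)) (ts [ x ]≔ t) ≡
           ts [ x ]≔ act (g (head t)) t
apply-at (_ ∷ ts) zero    g t = cong (_ ∷_) (apply-keep ts)
apply-at (s ∷ ts) (suc x) g t = cong (s ∷_) (apply-at ts x g t)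

-- The component of `ts` at `x` is a filler that the update overwrites. On an explicit vector the
-- update reduces, so this applies to every tape, with any tape put in as filler.
runs-at : ∀ {k} (ts : Tapes k) x {g} t →
          at x g ⊢ ts [ x ]≔ t ⇒[ 1 ] ts [ x ]≔ act (g (head t)) t
runs-at ts x {g} t = subst (Runs (at x g) tt _ 1) (apply-at ts x g t) (leave refl)

-- A program acts in the very step in which it leaves, whereas a machine halts without acting; the
-- additional state is where the machine stops.
machine : ∀ {w} → Program (2 + w) → Machine
machine {w} P = record
  { workTapes  = w
  ; State      = ⊤ ⊎ Control P
  ; stateCount = 1 + controlSize P
  ; finite     = ⊤-finite ⊎-finite control-finite P
  ; start      = inj₂ (entry P)
  ; transition = λ where
      (inj₁ tt) h → nothing
      (inj₂ p)  h → let a , p′ = transit P p h in just (maybe′ inj₂ (inj₁ tt) p′ , a)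
  }

module _ {w} {P : Program (2 + w)} where
  open Run (machine P)

  machine-runs : ∀ {p ts t us} → Runs P p ts t us → (inj₂ p , ts) ⇓[ t ] (inj₁ tt , us)
  machine-runs {ts = ts} (leave e)   =
    next (cong (λ (a , p) → just (maybe′ inj₂ (inj₁ tt) p , apply a ts)) e) (halted refl)
  machine-runs {ts = ts} (enter e r) =
    next (cong (λ (a , p) → just (maybe′ inj₂ (inj₁ tt) p , apply a ts)) e) (machine-runs r)

-- Tapes as zippers, rewinding and searching.

loop : ℕ → ℕ → ℕ
-- The last test, which fails, still takes a step.
loop zero    t = 1
loop (suc n) t = suc (t + loop n t)

-- An exhausted right part means that a blank is scanned; this keeps statements about moving right
-- free of a case distinction.
cells : List Symbol → List Symbol → Tape
cells l []      = tape l nothing []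
cells l (s ∷ r) = tape l s r

-- The word reverse l ++ r between two blanks, with the head on the first letter of r.
zipper : Word → Word → Tape
zipper l r = cells (map just l ++ [ nothing ]) (map just r ++ [ nothing ])

isTrue isFalse : Symbol → Bool
isTrue  = Maybe.fromMaybe false
isFalse = Maybe.maybe′ not false

rewindTime : ℕ → ℕ
rewindTime n = 1 + (loop n 1 + 1)

loop-mono : ∀ {m n t} → m ≤ n → loop m t ≤ loop n t
loop-mono {n = zero}  z≤n                = ℕ.≤-refl
loop-mono {n = suc n} z≤n                = s≤s z≤n
loop-mono         {t = t} (s≤s m≤n) = s≤s (ℕ.+-monoʳ-≤ t (loop-mono m≤n))

rewind-mono : ∀ {m n} → m ≤ n → rewindTime m ≤ rewindTime n
rewind-mono m≤n = s≤s (ℕ.+-monoˡ-≤ 1 (loop-mono m≤n))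

module _ {k : ℕ} where

  goRight goLeft : Fin k → Program k
  goRight x = at x (_, right)
  goLeft  x = at x (_, left)

  put mark : Fin k → Bool → Program k
  put  x b = at x λ _ → just b , right
  mark x b = at x λ _ → just b , stay

  nonblank : Fin k → Heads k → Bool
  nonblank x h = is-just (lookup h x)

  rewind seek : Fin k → Program k
  -- The head may stand on the blank behind the word, where the loop would stop at once; hence the
  -- first move. The last one leaves the blank in front of the word.
  rewind x = goLeft x ⨾ while (nonblank x) (goLeft x) ⨾ goRight x
  seek   x = while (λ h → isFalse (lookup h x)) (goRight x)

  move-right : ∀ l s r → move right (tape l s r) ≡ cells (s ∷ l) r
  move-right l s []      = refl
  move-right l s (_ ∷ _) = refl

  module _ (ts : Tapes k) (x : Fin k) where

    runs-right : ∀ {f : Symbol → Symbol} l s r →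
                 at x (λ s → f s , right) ⊢ ts [ x ]≔ cells l (s ∷ r) ⇒[ 1 ]
                 ts [ x ]≔ cells (f s ∷ l) r
    runs-right {f} l s r =
      subst (λ t → at x (λ s → f s , right) ⊢ ts [ x ]≔ cells l (s ∷ r) ⇒[ 1 ] ts [ x ]≔ t)
        (move-right l (f s) r) (runs-at ts x (cells l (s ∷ r)))

    runs-put : ∀ b l r → put x b ⊢ ts [ x ]≔ cells l r ⇒[ 1 ]
               ts [ x ]≔ cells (just b ∷ l) (List.drop 1 r)
    runs-put b l []      = runs-at ts x (cells l [])
    runs-put b l (s ∷ r) = runs-right l s r

    runs-left : ∀ b l r → goLeft x ⊢ ts [ x ]≔ zipper (b ∷ l) r ⇒[ 1 ] ts [ x ]≔ zipper l (b ∷ r)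
    runs-left b l []      = runs-at ts x (zipper (b ∷ l) [])
    runs-left b l (c ∷ r) = runs-at ts x (zipper (b ∷ l) (c ∷ r))

    nonblank-head : ∀ t → nonblank x (heads (ts [ x ]≔ t)) ≡ is-just (head t)
    nonblank-head t = cong is-just (lookup-heads ts x t)

    private
      atStart : Word → Tape
      atStart r = tape [] nothing (map just r ++ [ nothing ])

      runs-left-end : ∀ r → goLeft x ⊢ ts [ x ]≔ zipper [] r ⇒[ 1 ] ts [ x ]≔ atStart r
      runs-left-end []      = runs-at ts x (zipper [] [])
      runs-left-end (b ∷ r) = runs-at ts x (zipper [] (b ∷ r))

      runs-back : ∀ l b r → while (nonblank x) (goLeft x) ⊢ ts [ x ]≔ zipper l (b ∷ r)
                  ⇒[ loop (suc (length l)) 1 ] ts [ x ]≔ atStart (l ʳ++ b ∷ r)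
      runs-back []      b r = while-next (nonblank-head (zipper [] (b ∷ r)))
                                (runs-left-end (b ∷ r)) (while-done (nonblank-head (atStart (b ∷ r))))
      runs-back (c ∷ l) b r = while-next (nonblank-head (zipper (c ∷ l) (b ∷ r)))
                                (runs-left c l (b ∷ r)) (runs-back l c (b ∷ r))

    runs-rewind : ∀ l r {n xs} → length l ≡ n → l ʳ++ r ≡ xs →
                  rewind x ⊢ ts [ x ]≔ zipper l r ⇒[ rewindTime n ] ts [ x ]≔ zipper [] xs
    runs-rewind []      r refl refl =
      runs-left-end r then while-done (nonblank-head (atStart r)) then runs-right [] nothing (map just r ++ [ nothing ])
    runs-rewind (b ∷ l) r refl refl =
      runs-left b l r then runs-back l b r then runs-right [] nothing (map just (l ʳ++ b ∷ r) ++ [ nothing ])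

    runs-seek : ∀ n l r {l′} → replicate n false ʳ++ l ≡ l′ →
                seek x ⊢ ts [ x ]≔ zipper l (replicate n false ++ true ∷ r)
                ⇒[ loop n 1 ] ts [ x ]≔ zipper l′ (true ∷ r)
    runs-seek zero    l r refl = while-done (cong isFalse (lookup-heads ts x (zipper l (true ∷ r))))
    runs-seek (suc n) l r e    =
      while-next (cong isFalse (lookup-heads ts x (zipper l (false ∷ replicate n false ++ true ∷ r))))
        (runs-right (map just l ++ [ nothing ]) (just false) _) (runs-seek n (false ∷ l) r e)

    -- A sweep moves the word, reversed, to the left of the head; rewinding restores it, so a tape
    -- can serve as a loop counter again.
    runs-rewind-swept : ∀ xs {n} → length xs ≡ n → rewind x ⊢ ts [ x ]≔ zipper (xs ʳ++ []) []
                        ⇒[ rewindTime n ] ts [ x ]≔ zipper [] xs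
    runs-rewind-swept xs refl = runs-rewind (xs ʳ++ []) []
      (trans (length-ʳ++ xs) (+-identityʳ _)) (trans (ʳ++-ʳ++ xs) (++-identityʳ xs))

infixl 3 _▷_

_▷_ : ∀ {k} {P : Program k} {ts t us vs} → P ⊢ ts ⇒[ t ] us → us ≡ vs → P ⊢ ts ⇒[ t ] vs
r ▷ refl = r

ticks : ℕ → Word
ticks n = replicate n false

rows : ∀ {m n} → (Fin m → Fin n → Bool) → Word
rows a = concat (tabulate λ u → tabulate (a u))

length-concat-tabulate : ∀ {A : Set} {m n} (f : Fin m → List A) → (∀ i → length (f i) ≡ n) →
                         length (concat (tabulate f)) ≡ m * n
length-concat-tabulate {m = zero}  f e = refl
length-concat-tabulate {m = suc m} f e = trans (length-++ (f zero))
  (cong₂ _+_ (e zero) (length-concat-tabulate (f ∘ suc) (e ∘ suc)))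

length-rows : ∀ {m n} (a : Fin m → Fin n → Bool) → length (rows a) ≡ m * n
length-rows a = length-concat-tabulate _ (λ u → length-tabulate (a u))

-- Reading the graphs

-- Tapes 2 and 3 hold one cell per vertex (true at w while the w-th basis matrix
-- is written), tape 4 one cell per entry of the adjacency matrix and tape 5 as
-- many ticks.

setup readSize copyBit load compare : Program 6
-- A blank tape differs from `zipper [] []` by the explicit blank on the left, which one move to the
-- right creates.
setup    = goRight 1F ⨾ goRight 2F ⨾ goRight 3F ⨾ goRight 4F ⨾ goRight 5F
readSize = while (λ h → isTrue (lookup h 0F)) (goRight 0F ⨾ put 2F false ⨾ put 3F false)
             ⨾ goRight 0F ⨾ rewind 2F ⨾ rewind 3F
copyBit  = when (λ h → isTrue (lookup h 0F)) (put 4F true) (put 4F false) ⨾ goRight 0F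
load     = while (nonblank 2F)
             (while (nonblank 3F) (copyBit ⨾ goRight 3F) ⨾ rewind 3F ⨾ goRight 2F)
             ⨾ rewind 2F ⨾ rewind 4F
-- The orders agree exactly when the terminator on tape 0 and the end of tape 2 are reached
-- together.
compare  = while (λ h → isTrue (lookup h 0F) ∧ nonblank 2F h) (goRight 0F ⨾ goRight 2F)

readSizeTime loadRowTime loadTime : ℕ → ℕ
readSizeTime n = loop n 3 + (1 + (rewindTime n + rewindTime n))
loadRowTime  n = loop n 4 + (rewindTime n + 1)
loadTime     n = loop n (loadRowTime n) + (rewindTime n + rewindTime (n * n))

runs-readSize : ∀ n li r o a t →
  readSize ⊢ cells li (map just (replicate n true ++ false ∷ r)) ∷ o ∷ zipper [] [] ∷ zipper [] [] ∷ a ∷ t ∷ []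
  ⇒[ readSizeTime n ]
  cells (just false ∷ (replicate n (just true) ʳ++ li)) (map just r) ∷ o ∷
    zipper [] (ticks n) ∷ zipper [] (ticks n) ∷ a ∷ t ∷ []
runs-readSize n li r o a t =
  count n li [] then
  runs-right (o ∷ o ∷ _ ∷ _ ∷ a ∷ t ∷ []) 0F _ (just false) (map just r) then
  runs-rewind-swept (_ ∷ o ∷ o ∷ _ ∷ a ∷ t ∷ []) 2F (ticks n) (length-replicate n) then
  runs-rewind-swept (_ ∷ o ∷ _ ∷ o ∷ a ∷ t ∷ []) 3F (ticks n) (length-replicate n)
  where
  count : ∀ n li l →
    while (λ h → isTrue (lookup h 0F)) (goRight 0F ⨾ put 2F false ⨾ put 3F false) ⊢
    cells li (map just (replicate n true ++ false ∷ r)) ∷ o ∷ zipper l [] ∷ zipper l [] ∷ a ∷ t ∷ []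
    ⇒[ loop n 3 ]
    cells (replicate n (just true) ʳ++ li) (just false ∷ map just r) ∷ o ∷
      zipper (ticks n ʳ++ l) [] ∷ zipper (ticks n ʳ++ l) [] ∷ a ∷ t ∷ []
  count zero    li l = while-done refl
  count (suc n) li l = while-next refl
    (runs-right (o ∷ o ∷ _ ∷ _ ∷ a ∷ t ∷ []) 0F li (just true) _ then
     runs-put (_ ∷ o ∷ o ∷ _ ∷ a ∷ t ∷ []) 2F false _ [ nothing ] then
     runs-put (_ ∷ o ∷ _ ∷ o ∷ a ∷ t ∷ []) 3F false _ [ nothing ])
    (count n (just true ∷ li) (false ∷ l))

-- Tape 4 may be blank or still hold the previous graph; dropping at most one cell covers both.
runs-copyBit : ∀ b li r o u v la s t →
  copyBit ⊢ cells li (just b ∷ r) ∷ o ∷ u ∷ v ∷ cells la s ∷ t ∷ [] ⇒[ 3 ]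
  cells (just b ∷ li) r ∷ o ∷ u ∷ v ∷ cells (just b ∷ la) (List.drop 1 s) ∷ t ∷ []
runs-copyBit true li r o u v la s t =
  when-true refl (runs-put (cells li (just true ∷ r) ∷ o ∷ u ∷ v ∷ o ∷ t ∷ []) 4F true la s) then
  runs-right (o ∷ o ∷ u ∷ v ∷ _ ∷ t ∷ []) 0F li (just true) r
runs-copyBit false li r o u v la s t =
  when-false refl (runs-put (cells li (just false ∷ r) ∷ o ∷ u ∷ v ∷ o ∷ t ∷ []) 4F false la s) then
  runs-right (o ∷ o ∷ u ∷ v ∷ _ ∷ t ∷ []) 0F li (just false) r

-- Unlike drop, skip unfolds on a variable list.
skip : ℕ → List Symbol → List Symbol
skip zero    s = s
skip (suc n) s = skip n (List.drop 1 s)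

skips : ℕ → ℕ → List Symbol → List Symbol
skips zero    n s = s
skips (suc k) n s = skips k n (skip n s)

skip-[] : ∀ n → skip n [] ≡ []
skip-[] zero    = refl
skip-[] (suc n) = skip-[] n

skips-[] : ∀ k n → skips k n [] ≡ []
skips-[] zero    n = refl
skips-[] (suc k) n = trans (cong (skips k n) (skip-[] n)) (skips-[] k n)

skip-row : ∀ n (f : Fin n → Bool) r → skip n (map just (tabulate f ++ r) ++ [ nothing ]) ≡ map just r ++ [ nothing ]
skip-row zero    f r = refl
skip-row (suc n) f r = skip-row n (f ∘ suc) r

skips-rows : ∀ k n (a : Fin k → Fin n → Bool) → skips k n (map just (rows a) ++ [ nothing ]) ≡ [ nothing ]
skips-rows zero    n a = refl
skips-rows (suc k) n a = trans (cong (skips k n) (skip-row n (a zero) _)) (skips-rows k n (a ∘ suc))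

-- The last hypothesis says that n² writes use up the former contents `s`. It holds for a fresh tape
-- and for the matrix of another graph of the same order.
runs-load : ∀ n (a : Fin n → Fin n → Bool) li r s o t →
  (∀ l → cells l (skips n n s) ≡ cells l [ nothing ]) →
  ∃[ li′ ] load ⊢
  cells li (map just (rows a ++ r)) ∷ o ∷ zipper [] (ticks n) ∷ zipper [] (ticks n) ∷ cells [ nothing ] s ∷ t ∷ []
  ⇒[ loadTime n ]
  cells li′ (map just r) ∷ o ∷ zipper [] (ticks n) ∷ zipper [] (ticks n) ∷ zipper [] (rows a) ∷ t ∷ []
runs-load n a li r s o t full = let li′ , run = loadRows n a li [] [] s in
  li′ ,
  ((run ▷ cong (λ A → cells li′ (map just r) ∷ o ∷ _ ∷ _ ∷ A ∷ t ∷ []) (full _)) then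
   runs-rewind-swept (_ ∷ o ∷ o ∷ _ ∷ _ ∷ t ∷ []) 2F (ticks n) (length-replicate n) then
   runs-rewind-swept (_ ∷ o ∷ _ ∷ _ ∷ o ∷ t ∷ []) 4F (rows a) (length-rows a))
  where
  loadRow : ∀ k (b : Fin k → Bool) r li u l la s →
    while (nonblank 3F) (copyBit ⨾ goRight 3F) ⊢
    cells li (map just (tabulate b ++ r)) ∷ o ∷ u ∷ zipper l (ticks k) ∷
      cells (map just la ++ [ nothing ]) s ∷ t ∷ []
    ⇒[ loop k 4 ]
    cells (map just (tabulate b) ʳ++ li) (map just r) ∷ o ∷ u ∷ zipper (ticks k ʳ++ l) [] ∷
      cells (map just (tabulate b ʳ++ la) ++ [ nothing ]) (skip k s) ∷ t ∷ []
  loadRow zero    b r li u l la s = while-done refl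
  loadRow (suc k) b r li u l la s = while-next refl
    (runs-copyBit (b zero) li _ o u _ _ s t then
     runs-right (_ ∷ o ∷ u ∷ o ∷ _ ∷ t ∷ []) 3F _ (just false) _)
    (loadRow k (b ∘ suc) r (just (b zero) ∷ li) u (false ∷ l) (b zero ∷ la) (List.drop 1 s))

  loadRows : ∀ k (a : Fin k → Fin n → Bool) li l la s →
    ∃[ li′ ] while (nonblank 2F) (while (nonblank 3F) (copyBit ⨾ goRight 3F) ⨾ rewind 3F ⨾ goRight 2F) ⊢
    cells li (map just (rows a ++ r)) ∷ o ∷ zipper l (ticks k) ∷ zipper [] (ticks n) ∷
      cells (map just la ++ [ nothing ]) s ∷ t ∷ []
    ⇒[ loop k (loadRowTime n) ]
    cells li′ (map just r) ∷ o ∷ zipper (ticks k ʳ++ l) [] ∷ zipper [] (ticks n) ∷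
      cells (map just (rows a ʳ++ la) ++ [ nothing ]) (skips k n s) ∷ t ∷ []
  loadRows zero    a li l la s = li , while-done refl
  loadRows (suc k) a li l la s
    with loadRows k (a ∘ suc) (map just (tabulate (a zero)) ʳ++ li) (false ∷ l) (tabulate (a zero) ʳ++ la) (skip n s)
  ... | li′ , run rewrite ++-assoc (tabulate (a zero)) (rows (a ∘ suc)) r
                        | ++-ʳ++ (tabulate (a zero)) {rows (a ∘ suc)} {la} =
    li′ , while-next refl
      (loadRow n (a zero) _ li _ [] la s then
       runs-rewind-swept (_ ∷ o ∷ _ ∷ o ∷ _ ∷ t ∷ []) 3F (ticks n) (length-replicate n) then
       runs-right (_ ∷ o ∷ o ∷ _ ∷ _ ∷ t ∷ []) 2F _ (just false) _)
      run

module _ (o v a t : Tape) where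

  runs-compare-equal : ∀ n li r l →
    compare ⊢ cells li (map just (replicate n true ++ false ∷ r)) ∷ o ∷ zipper l (ticks n) ∷ v ∷ a ∷ t ∷ []
    ⇒[ loop n 2 ]
    cells (replicate n (just true) ʳ++ li) (just false ∷ map just r) ∷ o ∷ zipper (ticks n ʳ++ l) [] ∷ v ∷ a ∷ t ∷ []
  runs-compare-equal zero    li r l = while-done refl
  runs-compare-equal (suc n) li r l = while-next refl
    (runs-right (o ∷ o ∷ _ ∷ v ∷ a ∷ t ∷ []) 0F li (just true) _ then
     runs-right (_ ∷ o ∷ o ∷ v ∷ a ∷ t ∷ []) 2F _ (just false) _)
    (runs-compare-equal n (just true ∷ li) r (false ∷ l))

  -- The branch that follows depends only on the test failing, so the final positions stay
  -- existential. The time is bounded by the order of the first graph, however large the second is.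
  runs-compare-unequal : ∀ m n li r l → n ≢ m →
    ∃₂ λ i u → isFalse (head i) ∧ not (is-just (head u)) ≡ false ×
    (compare ⊢ cells li (map just (replicate m true ++ false ∷ r)) ∷ o ∷ zipper l (ticks n) ∷ v ∷ a ∷ t ∷ []
     ⇒[ loop n 2 ] i ∷ o ∷ u ∷ v ∷ a ∷ t ∷ [])
  runs-compare-unequal zero    zero    li r l n≢m = contradiction refl n≢m
  runs-compare-unequal zero    (suc n) li r l n≢m = _ , _ , refl , weaken (s≤s z≤n) (while-done refl)
  runs-compare-unequal (suc m) zero    li r l n≢m = _ , _ , refl , while-done refl
  runs-compare-unequal (suc m) (suc n) li r l n≢m
    with runs-compare-unequal m n (just true ∷ li) r (false ∷ l) (n≢m ∘ cong suc)
  ... | i , u , differ , run = i , u , differ , while-next refl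
    (runs-right (o ∷ o ∷ _ ∷ v ∷ a ∷ t ∷ []) 0F li (just true) _ then
     runs-right (_ ∷ o ∷ o ∷ v ∷ a ∷ t ∷ []) 2F _ (just false) _)
    run

-- Writing the algebras

emit : Word → Program 6
-- A program cannot be empty, so the empty word takes a neutral action; hence the `suc` in the time.
emit []      = at 1F (_, stay)
emit (b ∷ w) = put 1F b ⨾ emit w

-- Tape 4 has exactly n² cells, so counting along it replaces a multiplication. The leading `true`
-- accounts for the index `zero`; tape 5 keeps n² for `writeZeros`.
writeSize : Program 6
writeSize = put 1F true ⨾ while (nonblank 4F) (goRight 4F ⨾ put 5F false ⨾ put 1F true)
              ⨾ put 1F false ⨾ rewind 4F ⨾ rewind 5F

writeSizeTime : ℕ → ℕ
writeSizeTime N = 1 + (loop N 3 + (1 + (rewindTime N + rewindTime N)))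

emitted : ∀ v w R {i u p a t} → _≡_ {A = Tapes 6}
  (i ∷ zipper (w ʳ++ (v ʳ++ R)) [] ∷ u ∷ p ∷ a ∷ t ∷ []) (i ∷ zipper ((v ++ w) ʳ++ R) [] ∷ u ∷ p ∷ a ∷ t ∷ [])
emitted v w R = cong (λ l → _ ∷ zipper l [] ∷ _ ∷ _ ∷ _ ∷ _ ∷ []) (sym (++-ʳ++ v {w} {R}))

module _ (i u v a t : Tape) where

  runs-emit : ∀ w R → emit w ⊢ i ∷ zipper R [] ∷ u ∷ v ∷ a ∷ t ∷ [] ⇒[ suc (length w) ]
              i ∷ zipper (w ʳ++ R) [] ∷ u ∷ v ∷ a ∷ t ∷ []
  runs-emit []      R = runs-at (i ∷ i ∷ u ∷ v ∷ a ∷ t ∷ []) 1F (zipper R [])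
  runs-emit (b ∷ w) R = runs-put (i ∷ i ∷ u ∷ v ∷ a ∷ t ∷ []) 1F b _ [ nothing ] then runs-emit w (b ∷ R)

runs-writeSize : ∀ xs {N} → length xs ≡ N → ∀ i R u v →
  writeSize ⊢ i ∷ zipper R [] ∷ u ∷ v ∷ zipper [] xs ∷ zipper [] [] ∷ [] ⇒[ writeSizeTime N ]
  i ∷ zipper (unary (suc N) ʳ++ R) [] ∷ u ∷ v ∷ zipper [] xs ∷ zipper [] (ticks N) ∷ []
runs-writeSize xs {N} refl i R u v =
  runs-put (i ∷ i ∷ u ∷ v ∷ _ ∷ _ ∷ []) 1F true _ [ nothing ] then
  count xs (true ∷ R) [] [] then
  runs-put (i ∷ i ∷ u ∷ v ∷ _ ∷ _ ∷ []) 1F false _ [ nothing ] then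
  runs-rewind-swept (i ∷ _ ∷ u ∷ v ∷ i ∷ _ ∷ []) 4F xs refl then
  (runs-rewind-swept (i ∷ _ ∷ u ∷ v ∷ _ ∷ i ∷ []) 5F (ticks N) (length-replicate N) ▷
   emitted (replicate N true) (false ∷ []) (true ∷ R))
  where
  count : ∀ ys R l l′ → while (nonblank 4F) (goRight 4F ⨾ put 5F false ⨾ put 1F true) ⊢
    i ∷ zipper R [] ∷ u ∷ v ∷ zipper l ys ∷ zipper l′ [] ∷ [] ⇒[ loop (length ys) 3 ]
    i ∷ zipper (replicate (length ys) true ʳ++ R) [] ∷ u ∷ v ∷ zipper (ys ʳ++ l) [] ∷ zipper (ticks (length ys) ʳ++ l′) [] ∷ []
  count []       R l l′ = while-done refl
  count (y ∷ ys) R l l′ = while-next refl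
    (runs-right (i ∷ _ ∷ u ∷ v ∷ i ∷ _ ∷ []) 4F _ (just y) _ then
     runs-put (i ∷ _ ∷ u ∷ v ∷ _ ∷ i ∷ []) 5F false _ [ nothing ] then
     runs-put (i ∷ i ∷ u ∷ v ∷ _ ∷ _ ∷ []) 1F true _ [ nothing ])
    (count ys (true ∷ R) (y ∷ l) (false ∷ l′))

unit : ∀ {n} → Fin n → Fin n → Bool
unit w u = does (w ≟ u)

copies : Word → ℕ → Word
copies w n = concat (replicate n w)

-- The majority of three. With `x` and `y` telling whether `w` is `u` or `v`, equal votes decide
-- when `u` is `v`; otherwise at most one of them is true and the adjacency bit decides. So a digit
-- is determined by three heads, without a test of `u` against `v`.
vote : Bool → Bool → Bool → Bool
vote x y b = if x then y ∨ b else y ∧ b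

module _ (Z O : Word) where

  digit : Bool → Word
  digit b = if b then O else Z

  zeros : ℕ → Word
  zeros = copies Z

  -- In row-major order, successive diagonal entries of a matrix of size `suc N` are separated by
  -- `suc N` zeros. `x` is the mark at the first vertex of the pairs, `m` gives the marks at the
  -- second.
  rowWord : ∀ {n} → ℕ → Bool → (Fin n → Bool) → (Fin n → Bool) → Word
  rowWord N x m b = concat (tabulate λ v → zeros (suc N) ++ digit (vote x (m v) (b v)))

  matrixWord : ∀ {n} → ℕ → (Fin n → Bool) → (Fin n → Fin n → Bool) → Word
  matrixWord N m a = Z ++ concat (tabulate λ u → rowWord N (m u) m (a u))

  algebraWord : ∀ {n} → (Fin n → Fin n → Bool) → Word
  algebraWord {n} a = concat (tabulate λ w → true ∷ matrixWord (n * n) (unit w) a) ++ false ∷ []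

  writeZeros writeDigit writeRow writeMatrix writeAlgebra : Program 6
  writeZeros   = emit Z ⨾ while (nonblank 5F) (goRight 5F ⨾ emit Z) ⨾ rewind 5F
  writeDigit   = when (λ h → vote (isTrue (lookup h 2F)) (isTrue (lookup h 3F)) (isTrue (lookup h 4F)))
                   (emit O) (emit Z)
  writeRow     = while (nonblank 3F) (writeZeros ⨾ writeDigit ⨾ goRight 3F ⨾ goRight 4F)
  writeMatrix  = emit Z ⨾ while (nonblank 2F) (writeRow ⨾ rewind 3F ⨾ goRight 2F)
                   ⨾ rewind 2F ⨾ rewind 4F
  writeAlgebra =
    while (nonblank 2F)
      -- The `true` announces a further basis matrix in the encoding. The marks double as bookmarks:
      -- `seek` finds them again, and erasing them moves on to the next vertex.
      (put 1F true ⨾ mark 2F true ⨾ mark 3F true ⨾ rewind 2F ⨾ rewind 3F ⨾ writeMatrix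
         ⨾ seek 2F ⨾ seek 3F ⨾ put 2F false ⨾ put 3F false)
      ⨾ put 1F false ⨾ rewind 2F ⨾ rewind 3F

  -- Covers either letter, so that no time bound depends on the entries written.
  letterTime : ℕ
  letterTime = suc (length Z + length O)

  writeZerosTime writeRowTime writeMatrixTime writeBasisTime writeAlgebraTime : ℕ → ℕ
  writeZerosTime N   = letterTime + (loop N (1 + letterTime) + rewindTime N)
  writeRowTime n     = loop n (writeZerosTime (n * n) + (suc letterTime + 2))
  writeMatrixTime n  = letterTime + (loop n (writeRowTime n + (rewindTime n + 1))
                         + (rewindTime n + rewindTime (n * n)))
  writeBasisTime n   = 3 + (rewindTime n + (rewindTime n + (writeMatrixTime n + (loop n 1 + (loop n 1 + 2)))))
  writeAlgebraTime n = loop n (writeBasisTime n) + (1 + (rewindTime n + rewindTime n))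

  module _ (i u v a : Tape) where

    runs-Z : ∀ R t → emit Z ⊢ i ∷ zipper R [] ∷ u ∷ v ∷ a ∷ t ∷ [] ⇒[ letterTime ]
             i ∷ zipper (Z ʳ++ R) [] ∷ u ∷ v ∷ a ∷ t ∷ []
    runs-Z R t = weaken (s≤s (m≤m+n _ _)) (runs-emit i u v a t Z R)

    runs-O : ∀ R t → emit O ⊢ i ∷ zipper R [] ∷ u ∷ v ∷ a ∷ t ∷ [] ⇒[ letterTime ]
             i ∷ zipper (O ʳ++ R) [] ∷ u ∷ v ∷ a ∷ t ∷ []
    runs-O R t = weaken (s≤s (m≤n+m _ (length Z))) (runs-emit i u v a t O R)

    runs-writeZeros : ∀ N R →
      writeZeros ⊢ i ∷ zipper R [] ∷ u ∷ v ∷ a ∷ zipper [] (ticks N) ∷ [] ⇒[ writeZerosTime N ]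
      i ∷ zipper (zeros (suc N) ʳ++ R) [] ∷ u ∷ v ∷ a ∷ zipper [] (ticks N) ∷ []
    runs-writeZeros N R =
      runs-Z R _ then repeat N (Z ʳ++ R) [] then
      (runs-rewind-swept (i ∷ _ ∷ u ∷ v ∷ a ∷ i ∷ []) 5F (ticks N) (length-replicate N) ▷ emitted Z (zeros N) R)
      where
      repeat : ∀ N R l → while (nonblank 5F) (goRight 5F ⨾ emit Z) ⊢
        i ∷ zipper R [] ∷ u ∷ v ∷ a ∷ zipper l (ticks N) ∷ [] ⇒[ loop N (1 + letterTime) ]
        i ∷ zipper (zeros N ʳ++ R) [] ∷ u ∷ v ∷ a ∷ zipper (ticks N ʳ++ l) [] ∷ []
      repeat zero    R l = while-done refl
      repeat (suc N) R l =
        while-next refl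
          (runs-right (i ∷ _ ∷ u ∷ v ∷ a ∷ i ∷ []) 5F _ (just false) _ then runs-Z R _)
          (repeat N (Z ʳ++ R) (false ∷ l)) ▷ emitted Z (zeros N) R

  runs-writeDigit : ∀ x y b i R lu ru lv rv la ra t →
    writeDigit ⊢ i ∷ zipper R [] ∷ zipper lu (x ∷ ru) ∷ zipper lv (y ∷ rv) ∷ zipper la (b ∷ ra) ∷ t ∷ []
    ⇒[ suc letterTime ]
    i ∷ zipper (digit (vote x y b) ʳ++ R) [] ∷ zipper lu (x ∷ ru) ∷ zipper lv (y ∷ rv) ∷ zipper la (b ∷ ra) ∷ t ∷ []
  runs-writeDigit x y b i R lu ru lv rv la ra t with vote x y b in e
  ... | true  = when-true e (runs-O _ _ _ _ R t)
  ... | false = when-false e (runs-Z _ _ _ _ R t)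

  runs-writeRow : ∀ N k x (m b : Fin k → Bool) i R lu ru lv la ra →
    writeRow ⊢ i ∷ zipper R [] ∷ zipper lu (x ∷ ru) ∷ zipper lv (tabulate m) ∷ zipper la (tabulate b ++ ra) ∷ zipper [] (ticks N) ∷ []
    ⇒[ loop k (writeZerosTime N + (suc letterTime + 2)) ]
    i ∷ zipper (rowWord N x m b ʳ++ R) [] ∷ zipper lu (x ∷ ru) ∷ zipper (tabulate m ʳ++ lv) [] ∷
      zipper (tabulate b ʳ++ la) ra ∷ zipper [] (ticks N) ∷ []
  runs-writeRow N zero    x m b i R lu ru lv la ra = while-done refl
  runs-writeRow N (suc k) x m b i R lu ru lv la ra =
    while-next refl
      (runs-writeZeros _ _ _ _ N R then
       (runs-writeDigit x (m zero) (b zero) i _ lu ru lv _ la _ _ ▷ emitted (zeros (suc N)) D R) then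
       runs-right (i ∷ _ ∷ _ ∷ i ∷ _ ∷ _ ∷ []) 3F _ (just (m zero)) _ then
       runs-right (i ∷ _ ∷ _ ∷ _ ∷ i ∷ _ ∷ []) 4F _ (just (b zero)) _)
      (runs-writeRow N k x (m ∘ suc) (b ∘ suc) i _ lu ru (m zero ∷ lv) (b zero ∷ la) ra) ▷
    emitted (zeros (suc N) ++ D) (rowWord N x (m ∘ suc) (b ∘ suc)) R
    where
    D = digit (vote x (m zero) (b zero))

  runs-writeMatrix : ∀ n (m : Fin n → Bool) (a : Fin n → Fin n → Bool) i R →
    writeMatrix ⊢ i ∷ zipper R [] ∷ zipper [] (tabulate m) ∷ zipper [] (tabulate m) ∷ zipper [] (rows a) ∷ zipper [] (ticks (n * n)) ∷ []
    ⇒[ writeMatrixTime n ]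
    i ∷ zipper (matrixWord (n * n) m a ʳ++ R) [] ∷ zipper [] (tabulate m) ∷ zipper [] (tabulate m) ∷ zipper [] (rows a) ∷ zipper [] (ticks (n * n)) ∷ []
  runs-writeMatrix n m a i R =
    runs-Z _ _ _ _ R _ then
    writeRows n m a (Z ʳ++ R) [] [] then
    runs-rewind-swept (i ∷ _ ∷ i ∷ _ ∷ _ ∷ _ ∷ []) 2F (tabulate m) (length-tabulate m) then
    (runs-rewind-swept (i ∷ _ ∷ _ ∷ _ ∷ i ∷ _ ∷ []) 4F (rows a) (length-rows a) ▷
     emitted Z (concat (tabulate λ u → rowWord (n * n) (m u) m (a u))) R)
    where
    -- Tape 2 is consumed row by row, so its remaining marks are generalised to `x`, while tape 3
    -- offers all of `m` to every row.
    writeRows : ∀ k (x : Fin k → Bool) (a : Fin k → Fin n → Bool) R lu la →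
      while (nonblank 2F) (writeRow ⨾ rewind 3F ⨾ goRight 2F) ⊢
      i ∷ zipper R [] ∷ zipper lu (tabulate x) ∷ zipper [] (tabulate m) ∷ zipper la (rows a) ∷ zipper [] (ticks (n * n)) ∷ []
      ⇒[ loop k (writeRowTime n + (rewindTime n + 1)) ]
      i ∷ zipper (concat (tabulate λ u → rowWord (n * n) (x u) m (a u)) ʳ++ R) [] ∷ zipper (tabulate x ʳ++ lu) [] ∷
        zipper [] (tabulate m) ∷ zipper (rows a ʳ++ la) [] ∷ zipper [] (ticks (n * n)) ∷ []
    writeRows zero    x a R lu la = while-done refl
    writeRows (suc k) x a R lu la =
      while-next refl
        (runs-writeRow (n * n) n (x zero) m (a zero) i R lu _ [] la _ then
         runs-rewind-swept (i ∷ _ ∷ _ ∷ i ∷ _ ∷ _ ∷ []) 3F (tabulate m) (length-tabulate m) then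
         runs-right (i ∷ _ ∷ i ∷ _ ∷ _ ∷ _ ∷ []) 2F _ (just (x zero)) _)
        (writeRows k (x ∘ suc) (a ∘ suc) _ (x zero ∷ lu) (tabulate (a zero) ʳ++ la)) ▷
      cong₂ (λ l l′ → _ ∷ zipper l [] ∷ _ ∷ _ ∷ zipper l′ [] ∷ _ ∷ [])
        (sym (++-ʳ++ (rowWord (n * n) (x zero) m (a zero)))) (sym (++-ʳ++ (tabulate (a zero))))

  tabulate-false : ∀ n → tabulate {n = n} (λ _ → false) ≡ ticks n
  tabulate-false zero    = refl
  tabulate-false (suc n) = cong (false ∷_) (tabulate-false n)

  tabulate-unit : ∀ {n} (w : Fin n) k → toℕ w + suc k ≡ n → tabulate (unit w) ≡ ticks (toℕ w) ++ true ∷ ticks k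
  tabulate-unit zero    k refl = cong (true ∷_) (tabulate-false k)
  tabulate-unit (suc w) k e    = cong (false ∷_) (tabulate-unit w k (ℕ.suc-injective e))

  ticks-++-∷ : ∀ i l → ticks i ++ false ∷ l ≡ false ∷ ticks i ++ l
  ticks-++-∷ zero    l = refl
  ticks-++-∷ (suc i) l = cong (false ∷_) (ticks-++-∷ i l)

  ticks-ʳ++ : ∀ i l → ticks i ʳ++ l ≡ ticks i ++ l
  ticks-ʳ++ zero    l = refl
  ticks-ʳ++ (suc i) l = trans (ticks-ʳ++ i (false ∷ l)) (ticks-++-∷ i l)

  module _ (n : ℕ) (a : Fin n → Fin n → Bool) (i : Tape) where

    runs-writeBasis : ∀ w j k → toℕ w ≡ j → j + suc k ≡ n → ∀ R →
      put 1F true ⨾ mark 2F true ⨾ mark 3F true ⨾ rewind 2F ⨾ rewind 3F ⨾ writeMatrix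
         ⨾ seek 2F ⨾ seek 3F ⨾ put 2F false ⨾ put 3F false ⊢
      i ∷ zipper R [] ∷ zipper (ticks j) (ticks (suc k)) ∷ zipper (ticks j) (ticks (suc k)) ∷ zipper [] (rows a) ∷ zipper [] (ticks (n * n)) ∷ []
      ⇒[ writeBasisTime n ]
      i ∷ zipper ((true ∷ matrixWord (n * n) (unit w) a) ʳ++ R) [] ∷ zipper (ticks (suc j)) (ticks k) ∷ zipper (ticks (suc j)) (ticks k) ∷
        zipper [] (rows a) ∷ zipper [] (ticks (n * n)) ∷ []
    runs-writeBasis w j k refl j+k≡n R =
      runs-put (i ∷ i ∷ _ ∷ _ ∷ _ ∷ _ ∷ []) 1F true _ [ nothing ] then
      runs-at (i ∷ _ ∷ i ∷ _ ∷ _ ∷ _ ∷ []) 2F (zipper (ticks j) (ticks (suc k))) then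
      runs-at (i ∷ _ ∷ _ ∷ i ∷ _ ∷ _ ∷ []) 3F (zipper (ticks j) (ticks (suc k))) then
      -- Only `j` cells are rewound; the bound `n` makes all rounds of the outer loop equally long.
      weaken (rewind-mono j≤n) (runs-rewind (i ∷ _ ∷ i ∷ _ ∷ _ ∷ _ ∷ []) 2F (ticks j) (true ∷ ticks k) (length-replicate j) marked) then
      weaken (rewind-mono j≤n) (runs-rewind (i ∷ _ ∷ _ ∷ i ∷ _ ∷ _ ∷ []) 3F (ticks j) (true ∷ ticks k) (length-replicate j) marked) then
      (runs-writeMatrix n (unit w) a i (true ∷ R) ▷
       cong (λ l → i ∷ out ∷ zipper [] l ∷ zipper [] l ∷ A ∷ T ∷ []) (tabulate-unit w k j+k≡n)) then
      weaken (loop-mono j≤n) (runs-seek (i ∷ out ∷ i ∷ _ ∷ A ∷ T ∷ []) 2F j [] (ticks k) swept) then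
      weaken (loop-mono j≤n) (runs-seek (i ∷ out ∷ _ ∷ i ∷ A ∷ T ∷ []) 3F j [] (ticks k) swept) then
      runs-put (i ∷ _ ∷ i ∷ _ ∷ _ ∷ _ ∷ []) 2F false _ (map just (true ∷ ticks k) ++ [ nothing ]) then
      runs-put (i ∷ _ ∷ _ ∷ i ∷ _ ∷ _ ∷ []) 3F false _ (map just (true ∷ ticks k) ++ [ nothing ])
      where
      out    = zipper ((true ∷ matrixWord (n * n) (unit w) a) ʳ++ R) []
      A      = zipper [] (rows a)
      T      = zipper [] (ticks (n * n))
      marked = trans (ticks-ʳ++ j _) (sym (tabulate-unit w k j+k≡n))
      swept  = trans (ticks-ʳ++ j []) (++-identityʳ _)
      j≤n    = subst (j ≤_) j+k≡n (m≤m+n j (suc k))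

    runs-writeAlgebra : ∀ R →
      writeAlgebra ⊢
      i ∷ zipper R [] ∷ zipper [] (ticks n) ∷ zipper [] (ticks n) ∷ zipper [] (rows a) ∷ zipper [] (ticks (n * n)) ∷ []
      ⇒[ writeAlgebraTime n ]
      i ∷ zipper (algebraWord a ʳ++ R) [] ∷ zipper [] (ticks n) ∷ zipper [] (ticks n) ∷ zipper [] (rows a) ∷ zipper [] (ticks (n * n)) ∷ []
    runs-writeAlgebra R =
      writeBases n 0 id (λ _ → refl) refl R then
      runs-put (i ∷ i ∷ _ ∷ _ ∷ _ ∷ _ ∷ []) 1F false _ [ nothing ] then
      runs-rewind (i ∷ _ ∷ i ∷ _ ∷ _ ∷ _ ∷ []) 2F (ticks n) [] (length-replicate n) swept then
      (runs-rewind (i ∷ _ ∷ _ ∷ i ∷ _ ∷ _ ∷ []) 3F (ticks n) [] (length-replicate n) swept ▷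
       emitted (concat (tabulate λ w → true ∷ matrixWord (n * n) (unit w) a)) (false ∷ []) R)
      where
      swept = trans (ticks-ʳ++ n []) (++-identityʳ _)

      -- `ι` enumerates the vertices from `j` on, so that the induction is on the number `k` of
      -- those left.
      writeBases : ∀ k j (ι : Fin k → Fin n) → (∀ w → toℕ (ι w) ≡ j + toℕ w) → j + k ≡ n → ∀ R →
        while (nonblank 2F)
          (put 1F true ⨾ mark 2F true ⨾ mark 3F true ⨾ rewind 2F ⨾ rewind 3F ⨾ writeMatrix
             ⨾ seek 2F ⨾ seek 3F ⨾ put 2F false ⨾ put 3F false) ⊢
        i ∷ zipper R [] ∷ zipper (ticks j) (ticks k) ∷ zipper (ticks j) (ticks k) ∷ zipper [] (rows a) ∷ zipper [] (ticks (n * n)) ∷ []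
        ⇒[ loop k (writeBasisTime n) ]
        i ∷ zipper (concat (tabulate λ w → true ∷ matrixWord (n * n) (unit (ι w)) a) ʳ++ R) [] ∷
          zipper (ticks n) [] ∷ zipper (ticks n) [] ∷ zipper [] (rows a) ∷ zipper [] (ticks (n * n)) ∷ []
      writeBases zero    j ι ι-suc j≡n R =
        while-done refl ▷
        cong (λ j → i ∷ _ ∷ zipper (ticks j) [] ∷ zipper (ticks j) [] ∷ _ ∷ _ ∷ []) (trans (sym (+-identityʳ j)) j≡n)
      writeBases (suc k) j ι ι-suc j+k≡n R =
        while-next refl
          (runs-writeBasis (ι zero) j k (trans (ι-suc zero) (+-identityʳ j)) j+k≡n R)
          (writeBases k (suc j) (ι ∘ suc) (λ w → trans (ι-suc (suc w)) (+-suc j (toℕ w))) (trans (sym (+-suc j k)) j+k≡n) _) ▷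
        emitted (true ∷ matrixWord (n * n) (unit (ι zero)) a) (concat (tabulate λ w → true ∷ matrixWord (n * n) (unit (ι (suc w))) a)) R

-- Running time

-- The shape of the bound in `PolynomialTime`: one constant is both factor and summand.
Polynomial : (ℕ → ℕ) → Set
Polynomial f = ∃₂ λ a k → ∀ n → f n ≤ a * n ^ k + a

poly-const : ∀ c → Polynomial (λ _ → c)
poly-const c = c , 0 , λ n → m≤n+m c _

poly-id : Polynomial (λ n → n)
poly-id = 1 , 1 , λ n → ℕ.≤-trans (ℕ.≤-reflexive (solve n)) (m≤m+n (1 * n ^ 1) 1)
  where
  solve : ∀ n → n ≡ 1 * (n * 1)
  solve = solve-∀

-- The summand 1 is for `n = 0`, where the power with exponent 0 is 1 and all others are 0.
^-≤ : ∀ n k l → n ^ k ≤ n ^ (k + l) + 1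
^-≤ zero    zero    l = m≤n+m 1 _
^-≤ zero    (suc k) l = z≤n
^-≤ (suc n) k       l = ℕ.≤-trans (ℕ.^-monoʳ-≤ (suc n) (m≤m+n k l)) (m≤m+n _ 1)

poly-+ : ∀ {f g} → Polynomial f → Polynomial g → Polynomial (λ n → f n + g n)
poly-+ {f} {g} (a , k , f≤) (b , l , g≤) = 2 * (a + b) , k + l , λ n → begin
  f n + g n                                                       ≤⟨ ℕ.+-mono-≤ (f≤ n) (g≤ n) ⟩
  (a * n ^ k + a) + (b * n ^ l + b)                               ≤⟨ ℕ.+-mono-≤ (ℕ.+-monoˡ-≤ a (ℕ.*-monoʳ-≤ a (^-≤ n k l)))
                                                                       (ℕ.+-monoˡ-≤ b (ℕ.*-monoʳ-≤ b (^-≤ n l k))) ⟩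
  (a * (n ^ (k + l) + 1) + a) + (b * (n ^ (l + k) + 1) + b)       ≡⟨ cong (λ j → (a * (n ^ (k + l) + 1) + a) + (b * (n ^ j + 1) + b)) (+-comm l k) ⟩
  -- Pads the coefficient of the power up to the constant term.
  (a * (n ^ (k + l) + 1) + a) + (b * (n ^ (k + l) + 1) + b)       ≤⟨ m≤m+n _ _ ⟩
  (a * (n ^ (k + l) + 1) + a) + (b * (n ^ (k + l) + 1) + b) + (a + b) * n ^ (k + l)
                                                                  ≡⟨ solve a b (n ^ (k + l)) ⟩
  2 * (a + b) * n ^ (k + l) + 2 * (a + b)                         ∎
  where
  open ℕ.≤-Reasoning
  solve : ∀ a b x → (a * (x + 1) + a) + (b * (x + 1) + b) + (a + b) * x ≡ 2 * (a + b) * x + 2 * (a + b)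
  solve = solve-∀

-- Of the four terms of the product, three are bounded by the power with exponent `k + l`, up to
-- constants; together with the fourth these make 3.
poly-* : ∀ {f g} → Polynomial f → Polynomial g → Polynomial (λ n → f n * g n)
poly-* {f} {g} (a , k , f≤) (b , l , g≤) = 3 * (a * b) , k + l , λ n → begin
  f n * g n                                                  ≤⟨ ℕ.*-mono-≤ (f≤ n) (g≤ n) ⟩
  (a * n ^ k + a) * (b * n ^ l + b)                          ≡⟨ expand a b (n ^ k) (n ^ l) ⟩
  (a * b) * (n ^ k * n ^ l + n ^ k + n ^ l + 1)              ≡⟨ cong (λ x → (a * b) * (x + n ^ k + n ^ l + 1)) (ℕ.^-distribˡ-+-* n k l) ⟨
  (a * b) * (n ^ (k + l) + n ^ k + n ^ l + 1)                ≤⟨ ℕ.*-monoʳ-≤ (a * b) (ℕ.+-monoˡ-≤ 1 (ℕ.+-mono-≤ (ℕ.+-monoʳ-≤ (n ^ (k + l)) (^-≤ n k l)) (^-≤ n l k))) ⟩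
  (a * b) * (n ^ (k + l) + (n ^ (k + l) + 1) + (n ^ (l + k) + 1) + 1)
                                                             ≡⟨ cong (λ j → (a * b) * (n ^ (k + l) + (n ^ (k + l) + 1) + (n ^ j + 1) + 1)) (+-comm l k) ⟩
  (a * b) * (n ^ (k + l) + (n ^ (k + l) + 1) + (n ^ (k + l) + 1) + 1)
                                                             ≡⟨ collect a b (n ^ (k + l)) ⟩
  3 * (a * b) * n ^ (k + l) + 3 * (a * b)                    ∎
  where
  open ℕ.≤-Reasoning
  expand : ∀ a b x y → (a * x + a) * (b * y + b) ≡ (a * b) * (x * y + x + y + 1)
  expand = solve-∀
  collect : ∀ a b x → (a * b) * (x + (x + 1) + (x + 1) + 1) ≡ 3 * (a * b) * x + 3 * (a * b)
  collect = solve-∀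

loop-closed : ∀ n t → n * suc t + 1 ≡ loop n t
loop-closed zero    t = refl
loop-closed (suc n) t = cong suc (trans (ℕ.+-assoc t (n * suc t) 1) (cong (t +_) (loop-closed n t)))

poly-loop : ∀ {f g} → Polynomial f → Polynomial g → Polynomial (λ n → loop (f n) (g n))
poly-loop {f} {g} p q =
  let a , k , h = poly-+ (poly-* p (poly-+ (poly-const 1) q)) (poly-const 1)
  in a , k , λ n → subst (_≤ a * n ^ k + a) (loop-closed (f n) (g n)) (h n)

poly-rewind : ∀ {f} → Polynomial f → Polynomial (λ n → rewindTime (f n))
poly-rewind p = poly-+ (poly-const 1) (poly-+ (poly-loop p (poly-const 1)) (poly-const 1))

module _ {k : ℕ} where

  reach : Fin k → Tapes k → ℕ
  reach x ts = length (before (lookup ts x))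

  reach-act : ∀ a t → length (before (act a t)) ≤ suc (length (before t))
  reach-act (s , left)  (tape []      h r)       = z≤n
  reach-act (s , left)  (tape (_ ∷ l) h r)       = ℕ.m≤n⇒m≤1+n (ℕ.m≤n⇒m≤1+n ℕ.≤-refl)
  reach-act (s , right) (tape l       h [])      = ℕ.≤-refl
  reach-act (s , right) (tape l       h (_ ∷ r)) = ℕ.≤-refl
  reach-act (s , stay)  (tape l       h r)       = ℕ.m≤n⇒m≤1+n ℕ.≤-refl

  reach-apply : ∀ x as ts → reach x (apply as ts) ≤ suc (reach x ts)
  reach-apply x as ts = subst (λ t → length (before t) ≤ suc (reach x ts))
    (sym (lookup-zipWith act x as ts)) (reach-act (lookup as x) (lookup ts x))

  -- A step leaves at most one more cell to the left of the head. Hence the running time bounds the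
  -- length of the output, and with it the time of the final rewind.
  reach-runs : ∀ {P} x {p ts t us} → Runs P p ts t us → reach x us ≤ t + reach x ts
  reach-runs x {ts = ts} (leave {t = t} {a = a} e) =
    ℕ.≤-trans (reach-apply x a ts) (s≤s (m≤n+m _ t))
  reach-runs x {ts = ts} (enter {t = t} {a = a} e r) = ℕ.≤-trans (reach-runs x r)
    (ℕ.≤-trans (ℕ.+-monoʳ-≤ t (reach-apply x a ts)) (ℕ.≤-reflexive (+-suc t _)))

readTape-zipper : ∀ w → readTape (zipper [] w) ≡ w
readTape-zipper []      = refl
readTape-zipper (b ∷ w) = cong (b ∷_) (bits w)
  where
  bits : ∀ w → bitsBeforeBlank (map just w ++ [ nothing ]) ≡ w
  bits []      = refl
  bits (b ∷ w) = cong (b ∷_) (bits w)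

wordTape-cells : ∀ w → cells [] (map just w) ≡ wordTape w
wordTape-cells []      = refl
wordTape-cells (b ∷ w) = refl

-- The whole machine

input : ∀ {m n} → (Fin m → Fin m → Bool) → (Fin n → Fin n → Bool) → Word
input {m} {n} a b = replicate m true ++ false ∷ rows a ++ replicate n true ++ false ∷ rows b

initialTapes : Word → Tapes 6
initialTapes w = wordTape w ∷ Vec.replicate _ blankTape

-- A bound in terms of `size` becomes one in terms of the input length, since the polynomial is
-- monotone.
program⇒polynomialTime : ∀ {a b} {A : Set a} {B : Set b} (encodeA : A → Word) (encodeB : B → Word) (f : A → B)
  (P : Program 6) {T : ℕ → ℕ} (size : A → ℕ) → Polynomial T → (∀ x → size x ≤ length (encodeA x)) →
  (∀ x → ∃[ us ] (P ⊢ initialTapes (encodeA x) ⇒[ T (size x) ] us) × readTape (lookup us 1F) ≡ encodeB (f x)) →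
  PolynomialTime encodeA encodeB f
program⇒polynomialTime encodeA encodeB f P size (a , k , T≤) size≤ computes =
  machine P , a , k , λ x →
    let us , run , out = computes x
        fast = ℕ.≤-trans (T≤ (size x)) (ℕ.+-monoˡ-≤ a (ℕ.*-monoʳ-≤ a (ℕ.^-monoˡ-≤ k (size≤ x))))
    in (inj₁ tt , us) , machine-runs (weaken fast run) , trans (output-readTape us) out
  where
  open Run (machine P)
  output-readTape : ∀ us → output (inj₁ tt , us) ≡ readTape (lookup us 1F)
  output-readTape (_ ∷ _ ∷ _) = refl

module _ (Z O D : Word) where

  transform body convert : Program 6
  -- `goRight` skips the terminator of the second order and `rewind` undoes `compare`. Tape 4 holds
  -- one graph at a time, so the first algebra is written before the second graph is loaded.
  transform = goRight 0F ⨾ rewind 2F ⨾ writeSize ⨾ writeAlgebra Z O ⨾ load ⨾ writeAlgebra Z O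
  body      = setup ⨾ readSize ⨾ load ⨾ compare ⨾
                when (λ h → isFalse (lookup h 0F) ∧ not (nonblank 2F h)) transform (emit D)
  convert   = body ⨾ rewind 1F

  transformTime bodyTime convertTime : ℕ → ℕ
  transformTime n = 1 + (rewindTime n + (writeSizeTime (n * n) +
                      (writeAlgebraTime Z O n + (loadTime n + writeAlgebraTime Z O n))))
  -- The sum of the times of both branches bounds each of them.
  bodyTime n      = 5 + (readSizeTime n + (loadTime n + (loop n 2 + suc (transformTime n + suc (length D)))))
  -- The summand 0 is the reach of the output tape at the start.
  convertTime n   = bodyTime n + rewindTime (bodyTime n + 0)

  poly-convertTime : Polynomial convertTime
  poly-convertTime = poly-+ bodyP (poly-rewind (poly-+ bodyP (c 0)))
    where
    c = poly-const
    id² = poly-* poly-id poly-id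
    rw  = poly-rewind poly-id
    rw² = poly-rewind id²
    loopP : ∀ {f} → Polynomial f → Polynomial (λ n → loop n (f n))
    loopP = poly-loop poly-id
    readP  = poly-+ (loopP (c 3)) (poly-+ (c 1) (poly-+ rw rw))
    loadP  = poly-+ (loopP (poly-+ (loopP (c 4)) (poly-+ rw (c 1)))) (poly-+ rw rw²)
    sizeP  = poly-+ (c 1) (poly-+ (poly-loop id² (c 3)) (poly-+ (c 1) (poly-+ rw² rw²)))
    -- The two letters are fixed before any graph is read, so this is a constant.
    letter = letterTime Z O
    zerosP = poly-+ (c letter) (poly-+ (poly-loop id² (c (1 + letter))) rw²)
    rowP   = loopP (poly-+ zerosP (c (suc letter + 2)))
    matrixP = poly-+ (c letter) (poly-+ (loopP (poly-+ rowP (poly-+ rw (c 1)))) (poly-+ rw rw²))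
    basisP = poly-+ (c 3) (poly-+ rw (poly-+ rw (poly-+ matrixP (poly-+ (loopP (c 1)) (poly-+ (loopP (c 1)) (c 2))))))
    algP   = poly-+ (loopP basisP) (poly-+ (c 1) (poly-+ rw rw))
    transP = poly-+ (c 1) (poly-+ rw (poly-+ sizeP (poly-+ algP (poly-+ loadP algP))))
    bodyP : Polynomial bodyTime
    bodyP  = poly-+ (c 5) (poly-+ readP (poly-+ loadP (poly-+ (loopP (c 2)) (poly-+ (c 1) (poly-+ transP (c (suc (length D))))))))

  runs-finish : ∀ {w n W i u v a t} →
    body ⊢ initialTapes w ⇒[ bodyTime n ] i ∷ zipper (W ʳ++ []) [] ∷ u ∷ v ∷ a ∷ t ∷ [] →
    convert ⊢ initialTapes w ⇒[ convertTime n ] i ∷ zipper [] W ∷ u ∷ v ∷ a ∷ t ∷ []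
  runs-finish {n = n} {W} {i} {u} {v} {a} {t} run =
    run then weaken (rewind-mono (ℕ.≤-trans written (reach-runs 1F run)))
              (runs-rewind-swept (i ∷ i ∷ u ∷ v ∷ a ∷ t ∷ []) 1F W refl)
    where
    written : length W ≤ length (map just (W ʳ++ []) ++ [ nothing ])
    written = begin
      length W                                     ≤⟨ m≤m+n _ 0 ⟩
      length W + 0                                 ≡⟨ length-ʳ++ W ⟨
      length (W ʳ++ [])                            ≡⟨ length-map just (W ʳ++ []) ⟨
      length (map just (W ʳ++ []))                 ≤⟨ m≤m+n _ 1 ⟩
      length (map just (W ʳ++ [])) + 1             ≡⟨ length-++ (map just (W ʳ++ [])) ⟨
      length (map just (W ʳ++ []) ++ [ nothing ])  ∎
      where
      open ℕ.≤-Reasoning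

  runs-setup : ∀ w → setup ⊢ initialTapes w ⇒[ 5 ]
    cells [] (map just w) ∷ zipper [] [] ∷ zipper [] [] ∷ zipper [] [] ∷ zipper [] [] ∷ zipper [] [] ∷ []
  runs-setup w rewrite wordTape-cells w =
    runs-right (W ∷ W ∷ _ ∷ _ ∷ _ ∷ _ ∷ []) 1F [] nothing [] then
    runs-right (W ∷ _ ∷ W ∷ _ ∷ _ ∷ _ ∷ []) 2F [] nothing [] then
    runs-right (W ∷ _ ∷ _ ∷ W ∷ _ ∷ _ ∷ []) 3F [] nothing [] then
    runs-right (W ∷ _ ∷ _ ∷ _ ∷ W ∷ _ ∷ []) 4F [] nothing [] then
    runs-right (W ∷ _ ∷ _ ∷ _ ∷ _ ∷ W ∷ []) 5F [] nothing []
    where W = wordTape w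

  -- The part common to both outcomes. `load` hides the input already consumed, so the continuation
  -- has to work for every `li`.
  runs-prefix : ∀ {m n} (a : Fin m → Fin m → Bool) (b : Fin n → Fin n → Bool) {P t} {us : List Symbol → Tapes 6} →
    (∀ li → compare ⨾ P ⊢ cells li (map just (replicate n true ++ false ∷ rows b)) ∷ zipper [] [] ∷ zipper [] (ticks m) ∷
       zipper [] (ticks m) ∷ zipper [] (rows a) ∷ zipper [] [] ∷ [] ⇒[ t ] us li) →
    ∃[ li ] setup ⨾ readSize ⨾ load ⨾ compare ⨾ P ⊢ initialTapes (input a b)
      ⇒[ 5 + (readSizeTime m + (loadTime m + t)) ] us li
  runs-prefix {m} {n} a b run =
    let li , runLoad = runs-load m a _ (replicate n true ++ false ∷ rows b) [] (zipper [] []) (zipper [] [])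
                         (λ l → cong (cells l) (skips-[] m m))
    in li , (runs-setup (input a b) then
             runs-readSize m [] (rows a ++ replicate n true ++ false ∷ rows b) (zipper [] []) (zipper [] []) (zipper [] []) then
             runLoad then run li)

  runs-convert-equal : ∀ {n} (a b : Fin n → Fin n → Bool) → ∃[ us ]
    (convert ⊢ initialTapes (input a b) ⇒[ convertTime n ] us) ×
    readTape (lookup us 1F) ≡ unary (suc (n * n)) ++ algebraWord Z O a ++ algebraWord Z O b
  runs-convert-equal {n} a b = _ , runs-finish {n = n} {W = W} (proj₂ prefix) , readTape-zipper W
    where
    W = unary (suc (n * n)) ++ algebraWord Z O a ++ algebraWord Z O b
    U = zipper [] (ticks n)
    T = zipper [] (ticks (n * n))
    B = unary (suc (n * n)) ʳ++ []
    full : ∀ l → cells l (skips n n (map just (rows a) ++ [ nothing ])) ≡ cells l [ nothing ]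
    full l = cong (cells l) (skips-rows n n a)
    reload : ∀ li → ∃[ li′ ] load ⊢
      cells li (map just (rows b)) ∷ zipper (algebraWord Z O a ʳ++ B) [] ∷ U ∷ U ∷ zipper [] (rows a) ∷ T ∷ [] ⇒[ loadTime n ]
      cells li′ [] ∷ zipper (algebraWord Z O a ʳ++ B) [] ∷ U ∷ U ∷ zipper [] (rows b) ∷ T ∷ []
    reload li with runs-load n b li [] (map just (rows a) ++ [ nothing ]) (zipper (algebraWord Z O a ʳ++ B) []) T full
    ... | li′ , run rewrite ++-identityʳ (rows b) = li′ , run
    atBits : List Symbol → List Symbol
    atBits li = just false ∷ (replicate n (just true) ʳ++ li)
    joined : algebraWord Z O b ʳ++ (algebraWord Z O a ʳ++ B) ≡ W ʳ++ []
    joined = sym (trans (++-ʳ++ (unary (suc (n * n)))) (++-ʳ++ (algebraWord Z O a)))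
    prefix = runs-prefix a b
      {us = λ li → cells (proj₁ (reload (atBits li))) [] ∷ zipper (W ʳ++ []) [] ∷ U ∷ U ∷ zipper [] (rows b) ∷ T ∷ []}
      λ li →
      runs-compare-equal (zipper [] []) U (zipper [] (rows a)) (zipper [] []) n li (rows b) [] then
      when-true refl
        (weaken (m≤m+n _ _)
        (runs-right (U ∷ zipper [] [] ∷ _ ∷ U ∷ _ ∷ _ ∷ []) 0F _ (just false) (map just (rows b)) then
         runs-rewind-swept (_ ∷ _ ∷ U ∷ U ∷ _ ∷ _ ∷ []) 2F (ticks n) (length-replicate n) then
         runs-writeSize (rows a) (length-rows a) _ [] U U then
         runs-writeAlgebra Z O n a _ B then
         proj₂ (reload (atBits li)) then
         (runs-writeAlgebra Z O n b _ _ ▷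
          cong (λ l → cells (proj₁ (reload (atBits li))) [] ∷ zipper l [] ∷ U ∷ U ∷ zipper [] (rows b) ∷ T ∷ []) joined)))

  runs-convert-unequal : ∀ {m n} (a : Fin m → Fin m → Bool) (b : Fin n → Fin n → Bool) → m ≢ n → ∃[ us ]
    (convert ⊢ initialTapes (input a b) ⇒[ convertTime m ] us) × readTape (lookup us 1F) ≡ D
  runs-convert-unequal {m} {n} a b m≢n = _ , runs-finish {n = m} {W = D} (proj₂ prefix) , readTape-zipper D
    where
    U = zipper [] (ticks m)
    A = zipper [] (rows a)
    compared : ∀ li → _
    compared li = runs-compare-unequal (zipper [] []) U A (zipper [] []) n m li (rows b) [] m≢n
    prefix = runs-prefix a b
      {us = λ li → proj₁ (compared li) ∷ zipper (D ʳ++ []) [] ∷ proj₁ (proj₂ (compared li)) ∷ U ∷ A ∷ zipper [] [] ∷ []}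
      λ li → let i , u , differ , run = compared li in
      run then when-false differ (weaken (m≤n+m _ (transformTime m)) (runs-emit i u U A (zipper [] []) D []))

-- Listings of diagonal matrices

module _ (z : Word) where

  diagonal : ∀ {n} → (Fin n → Word) → Fin n → Fin n → Word
  diagonal x i j = if does (i ≟ j) then x i else z

  diagonalRow : ∀ {n} → (Fin n → Word) → Fin n → Word
  diagonalRow x i = concat (tabulate (diagonal x i))

  concat-tabulate-const : ∀ n → concat (tabulate {n = n} λ _ → z) ≡ copies z n
  concat-tabulate-const zero    = refl
  concat-tabulate-const (suc n) = cong (z ++_) (concat-tabulate-const n)

  copies-+ : ∀ m n → copies z m ++ copies z n ≡ copies z (m + n)
  copies-+ zero    n = refl
  copies-+ (suc m) n = trans (++-assoc z _ _) (cong (z ++_) (copies-+ m n))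

  copies-suc : ∀ n → copies z n ++ z ≡ copies z (suc n)
  copies-suc n = trans (cong (copies z n ++_) (sym (++-identityʳ z)))
    (trans (copies-+ n 1) (cong (copies z) (+-comm n 1)))

  -- The zeros at the end of one row join those at the start of the next. Passing to the smaller
  -- matrix shortens the former by one and lengthens the latter by one, so `n + q` is the same for
  -- all blocks.
  interleave : ∀ n q (x : Fin n → Word) →
    copies z n ++ concat (tabulate λ i → copies z q ++ diagonalRow x i) ≡
    concat (tabulate λ i → copies z (n + q) ++ x i)
  interleave zero    q x = refl
  interleave (suc n) q x = begin
    copies z (suc n) ++ (copies z q ++ x zero ++ concat (tabulate {n = n} λ _ → z)) ++ rest
      ≡⟨ cong (λ w → copies z (suc n) ++ (copies z q ++ x zero ++ w) ++ rest) (concat-tabulate-const n) ⟩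
    copies z (suc n) ++ (copies z q ++ x zero ++ copies z n) ++ rest
      ≡⟨ cong (λ w → copies z (suc n) ++ w ++ rest) (sym (++-assoc (copies z q) (x zero) (copies z n))) ⟩
    copies z (suc n) ++ ((copies z q ++ x zero) ++ copies z n) ++ rest
      ≡⟨ cong (copies z (suc n) ++_) (++-assoc (copies z q ++ x zero) (copies z n) rest) ⟩
    copies z (suc n) ++ (copies z q ++ x zero) ++ copies z n ++ rest
      ≡⟨ sym (++-assoc (copies z (suc n)) (copies z q ++ x zero) (copies z n ++ rest)) ⟩
    (copies z (suc n) ++ copies z q ++ x zero) ++ copies z n ++ rest
      ≡⟨ cong₂ _++_ front tail ⟩
    (copies z (suc n + q) ++ x zero) ++ concat (tabulate λ i → copies z (suc n + q) ++ x (suc i)) ∎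
    where
    open ≡-Reasoning
    rest = concat (tabulate λ i → copies z q ++ z ++ diagonalRow (x ∘ suc) i)
    front : copies z (suc n) ++ copies z q ++ x zero ≡ copies z (suc n + q) ++ x zero
    front = trans (sym (++-assoc (copies z (suc n)) (copies z q) (x zero))) (cong (_++ x zero) (copies-+ (suc n) q))
    tail : copies z n ++ rest ≡ concat (tabulate λ i → copies z (suc n + q) ++ x (suc i))
    tail = begin
      copies z n ++ rest
        ≡⟨ cong (λ l → copies z n ++ concat l) (tabulate-cong λ i →
             trans (sym (++-assoc (copies z q) z _)) (cong (_++ diagonalRow (x ∘ suc) i) (copies-suc q))) ⟩
      copies z n ++ concat (tabulate λ i → copies z (suc q) ++ diagonalRow (x ∘ suc) i)
        ≡⟨ interleave n (suc q) (x ∘ suc) ⟩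
      concat (tabulate λ i → copies z (n + suc q) ++ x (suc i))
        ≡⟨ cong (λ k → concat (tabulate λ i → copies z k ++ x (suc i))) (+-suc n q) ⟩
      concat (tabulate λ i → copies z (suc n + q) ++ x (suc i)) ∎

  listing-diagonal : ∀ n (x : Fin (suc n) → Word) →
    listing (diagonal x) ≡ x zero ++ concat (tabulate λ i → copies z (suc n) ++ x (suc i))
  listing-diagonal n x = begin
    (x zero ++ concat (tabulate {n = n} λ _ → z)) ++ concat (tabulate λ i → z ++ diagonalRow (x ∘ suc) i)
      ≡⟨ cong₂ (λ w l → (x zero ++ w) ++ concat l) (concat-tabulate-const n)
           (tabulate-cong λ i → cong (_++ diagonalRow (x ∘ suc) i) (sym (++-identityʳ z))) ⟩
    (x zero ++ copies z n) ++ concat (tabulate λ i → copies z 1 ++ diagonalRow (x ∘ suc) i)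
      ≡⟨ ++-assoc (x zero) _ _ ⟩
    x zero ++ copies z n ++ concat (tabulate λ i → copies z 1 ++ diagonalRow (x ∘ suc) i)
      ≡⟨ cong (x zero ++_) (interleave n 1 (x ∘ suc)) ⟩
    x zero ++ concat (tabulate λ i → copies z (n + 1) ++ x (suc i))
      ≡⟨ cong (λ k → x zero ++ concat (tabulate λ i → copies z k ++ x (suc i))) (+-comm n 1) ⟩
    x zero ++ concat (tabulate λ i → copies z (suc n) ++ x (suc i)) ∎
    where open ≡-Reasoning

module _ {A : Set} where

  concat-tabulate-+ : ∀ m n (f : Fin (m + n) → List A) →
    concat (tabulate f) ≡ concat (tabulate (f ∘ (_↑ˡ n))) ++ concat (tabulate (f ∘ (m ↑ʳ_)))
  concat-tabulate-+ zero    n f = refl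
  concat-tabulate-+ (suc m) n f =
    trans (cong (f zero ++_) (concat-tabulate-+ m n (f ∘ suc))) (sym (++-assoc (f zero) _ _))

  -- `remQuot` enumerates pairs lexicographically, the order in which the nested loops of the
  -- machine write them.
  concat-tabulate-* : ∀ m n (f : Fin m × Fin n → List A) →
    concat (tabulate (f ∘ remQuot {m} n)) ≡ concat (tabulate λ i → concat (tabulate λ j → f (i , j)))
  concat-tabulate-* zero    n f = refl
  concat-tabulate-* (suc m) n f = begin
    concat (tabulate (f ∘ remQuot {suc m} n))
      ≡⟨ concat-tabulate-+ n (m * n) (f ∘ remQuot {suc m} n) ⟩
    concat (tabulate (λ j → f (remQuot {suc m} n (j ↑ˡ (m * n))))) ++
      concat (tabulate (λ p → f (remQuot {suc m} n (n ↑ʳ p))))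
      ≡⟨ cong₂ (λ k l → concat k ++ concat l) (tabulate-cong (cong f ∘ first)) (tabulate-cong (cong f ∘ later)) ⟩
    concat (tabulate (λ j → f (zero , j))) ++ concat (tabulate (f ∘ shift ∘ remQuot {m} n))
      ≡⟨ cong (concat (tabulate (λ j → f (zero , j))) ++_) (concat-tabulate-* m n (f ∘ shift)) ⟩
    concat (tabulate λ i → concat (tabulate λ j → f (i , j))) ∎
    where
    open ≡-Reasoning
    shift : Fin m × Fin n → Fin (suc m) × Fin n
    shift (i , j) = suc i , j
    first : ∀ j → remQuot {suc m} n (j ↑ˡ (m * n)) ≡ (zero , j)
    first j rewrite splitAt-↑ˡ n j (m * n) = refl
    later : ∀ p → remQuot {suc m} n (n ↑ʳ p) ≡ shift (remQuot {m} n p)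
    later p rewrite splitAt-↑ʳ n (m * n) p = refl

-- The code of a graph

-- The order is a parameter, unlike in `Graph`: once two orders are identified, both graphs live on
-- the same `Fin n`.
record Adjacency (n : ℕ) : Set where
  field
    adjacent    : Fin n → Fin n → Bool
    symmetric   : ∀ i j → adjacent i j ≡ adjacent j i
    irreflexive : ∀ i → adjacent i i ≡ false

  graph : Graph
  graph = record { vertices = n ; adjacent = adjacent ; symmetric = symmetric ; irreflexive = irreflexive }

adjacency : (G : Graph) → Adjacency (Graph.vertices G)
adjacency G = record { Graph G }

module _ {n : ℕ} where

  incident : (Fin n → Fin n → Bool) → Fin n → Fin n × Fin n → Bool
  incident a w (u , v) = vote (unit w u) (unit w v) (a u v)

  -- As a functional, index (u , v) is e_u if u = v, e_u + e_v if u and v are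
  -- adjacent, and 0 otherwise; index zero is 0 as well.
  code : (Fin n → Fin n → Bool) → Fin n → Fin (suc (n * n)) → Bool
  code a w zero    = false
  code a w (suc p) = incident a w (remQuot n p)

  pair : Fin n → Fin n → Fin (suc (n * n))
  pair u v = suc (combine u v)

  code-pair : ∀ a w u v → code a w (pair u v) ≡ vote (unit w u) (unit w v) (a u v)
  code-pair a w u v = cong (incident a w) (remQuot-combine u v)

  data View : Fin (suc (n * n)) → Set where
    none  : View zero
    both  : ∀ u v → View (pair u v)

  view : ∀ i → View i
  view zero    = none
  view (suc p) = subst (View ∘ suc) (combine-remQuot {n} n p) (both (proj₁ (remQuot {n} n p)) (proj₂ (remQuot {n} n p)))

  unit-refl : ∀ (u : Fin n) → unit u u ≡ true
  unit-refl u = dec-true (u ≟ u) refl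

  unit-true : ∀ {u v : Fin n} → unit u v ≡ true → u ≡ v
  unit-true {u} {v} e with u ≟ v
  ... | yes u≡v = u≡v

  unit-false : ∀ {u v : Fin n} → u ≢ v → unit u v ≡ false
  unit-false {u} {v} = dec-false (u ≟ v)

  -- Two equal votes decide, whatever the third. These positions are the pivots for linear
  -- independence.
  code-vertex : ∀ a w v → code a w (pair v v) ≡ unit w v
  code-vertex a w v rewrite code-pair a w v v with unit w v
  ... | true  = refl
  ... | false = refl

  module _ (G : Adjacency n) where
    open Adjacency G

    -- This is where an edge gets its multiplicity two.
    code-symmetric : ∀ w u v → code adjacent w (pair u v) ≡ code adjacent w (pair v u)
    code-symmetric w u v rewrite code-pair adjacent w u v | code-pair adjacent w v u | symmetric u v
      with unit w u | unit w v
    ... | true  | true  = refl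
    ... | true  | false = refl
    ... | false | true  = refl
    ... | false | false = refl

    code-source : ∀ {u v} → adjacent u v ≡ true → code adjacent u (pair u v) ≡ true
    code-source {u} {v} uv rewrite code-pair adjacent u u v | unit-refl u | uv with unit u v
    ... | true  = refl
    ... | false = refl

    code-target : ∀ {u v} → adjacent u v ≡ true → code adjacent v (pair u v) ≡ true
    code-target {u} {v} uv = trans (code-symmetric v u v) (code-source (trans (symmetric v u) uv))

    code-nonadjacent : ∀ w {u v} → u ≢ v → adjacent u v ≡ false → code adjacent w (pair u v) ≡ false
    code-nonadjacent w {u} {v} u≢v uv rewrite code-pair adjacent w u v | uv with w ≟ u | w ≟ v
    ... | yes refl | yes refl = contradiction refl u≢v
    ... | yes _    | no _     = refl
    ... | no _     | yes _    = refl
    ... | no _     | no _     = refl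

    code-endpoint : ∀ w u v → code adjacent w (pair u v) ≡ true → w ≡ u × (w ≡ v ⊎ adjacent u v ≡ true) ⊎ w ≡ v × adjacent u v ≡ true
    code-endpoint w u v e rewrite code-pair adjacent w u v with w ≟ u | w ≟ v
    ... | yes w≡u | yes w≡v = inj₁ (w≡u , inj₁ w≡v)
    ... | yes w≡u | no _    = inj₁ (w≡u , inj₂ e)
    ... | no _    | yes w≡v = inj₂ (w≡v , e)

    -- Only the position of an edge involves two distinct vertices, so adjacency can be read off
    -- from the code.
    code-edge : ∀ {s t} i → s ≢ t → code adjacent s i ≡ true → code adjacent t i ≡ true → adjacent s t ≡ true
    code-edge {s} {t} i s≢t si ti with view i
    ... | both u v with code-endpoint s u v si | code-endpoint t u v ti
    ... | inj₁ (refl , _) | inj₁ (refl , _)      = contradiction refl s≢t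
    ... | inj₁ (refl , _) | inj₂ (refl , uv)     = uv
    ... | inj₂ (refl , _) | inj₂ (refl , _)      = contradiction refl s≢t
    ... | inj₂ (refl , uv) | inj₁ (refl , _)     = trans (symmetric v u) uv

    vertex-simple : ∀ v i → (∀ w → code adjacent w i ≡ code adjacent w (pair v v)) → i ≡ pair v v
    vertex-simple v i same = go (view i) λ w → trans (same w) (code-vertex adjacent w v)
      where
      go : ∀ {i} → View i → (∀ w → code adjacent w i ≡ unit w v) → i ≡ pair v v
      go none e = contradiction (trans (e v) (unit-refl v)) λ ()
      go (both u u′) e with u ≟ u′ | adjacent u u′ in uu′
      ... | yes refl | _     = cong (λ w → pair w w) (unit-true (trans (sym (e u)) (trans (code-vertex adjacent u u) (unit-refl u))))
      -- Both ends of an edge lie in the support, so both would have to be `v`.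
      ... | no u≢u′  | true  = contradiction
        (trans (unit-true (trans (sym (e u)) (code-source uu′))) (sym (unit-true (trans (sym (e u′)) (code-target uu′))))) u≢u′
      ... | no u≢u′  | false = contradiction
        (trans (sym (code-nonadjacent v u≢u′ uu′)) (trans (e v) (unit-refl v))) λ ()

-- Adding a missed value `w` to the list of values would embed n + 1 elements into n.
injective⇒surjective : ∀ {n} (f : Fin n → Fin n) → (∀ {u v} → f u ≡ f v → u ≡ v) → ∀ w → ∃[ v ] f v ≡ w
injective⇒surjective {n} f f-injective w with any? (λ v → f v ≟ w)
... | yes found = found
... | no missed with pigeonhole (ℕ.n<1+n n) g
  where
  g : Fin (suc n) → Fin n
  g zero    = w
  g (suc v) = f v
... | zero  , suc v , _   , w≡fv  = contradiction (v , sym w≡fv) missed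
... | suc u , suc v , u<v , fu≡fv = contradiction (cong suc (f-injective fu≡fv)) (<⇒≢ u<v)

-- The Lie algebra of a graph.

module _ {c ℓ₁ ℓ₂} (F : HeytingField c ℓ₁ ℓ₂) (N : Notation F) where

  open HeytingField F using (heytingCommutativeRing)
  open CommutativeRing (HeytingCommutativeRing.commutativeRing heytingCommutativeRing)
    using (Carrier; _≈_; 0#; *-congˡ; *-congʳ; zeroˡ; zeroʳ; *-identityˡ; reflexive) renaming (sym to ≈-sym; trans to ≈-trans)
  open FieldLemmas F
  open Notation N

  -- 0 and 1 may have several names; fixing one of each makes the output a definite word.
  zeroName oneName zeroLetter oneLetter : Word
  zeroName   = proj₁ zeroᴺ
  oneName    = proj₁ oneᴺ
  zeroLetter = encodeName F N zeroName
  oneLetter  = encodeName F N oneName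

  bitName : Bool → Word
  bitName b = if b then oneName else zeroName

  ⟦bitName⟧ : ∀ b → ⟦ bitName b ⟧ ≈ bit b
  ⟦bitName⟧ true  = proj₂ oneᴺ
  ⟦bitName⟧ false = proj₂ zeroᴺ

  module _ {n : ℕ} (G : Adjacency n) where
    open Adjacency G

    graphNames : Fin n → Fin (suc (n * n)) → Fin (suc (n * n)) → Word
    graphNames k i j = if does (i ≟ j) then bitName (code adjacent k i) else zeroName

    graphBasis : Fin n → Matrix F (suc (n * n))
    graphBasis k i j = ⟦ graphNames k i j ⟧

    graphBasis-spans : Spans graphBasis (code adjacent)
    graphBasis-spans = record
      { onDiagonal  = λ k i → ≈-trans
          (reflexive (cong (λ b → ⟦ if b then bitName (code adjacent k i) else zeroName ⟧) (dec-true (i ≟ i) refl)))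
          (⟦bitName⟧ (code adjacent k i))
      ; offDiagonal = λ k i j i≢j → ≈-trans
          (reflexive (cong (λ b → ⟦ if b then bitName (code adjacent k i) else zeroName ⟧) (dec-false (i ≟ j) i≢j)))
          (proj₂ zeroᴺ)
      }
    open Spans graphBasis-spans

    lieAlgebra : LieAlgebra F N (suc (n * n))
    lieAlgebra = record
      { dimension    = n
      ; names        = graphNames
      ; independent  = pivots⇒independent graphBasis-spans (λ v → pair v v) (λ v w → code-vertex adjacent w v)
      ; isLieAlgebra = span-isLieAlgebra graphBasis offDiagonal
      }

    encode-lieAlgebra : encodeLieAlgebra F N lieAlgebra ≡ algebraWord zeroLetter oneLetter adjacent
    encode-lieAlgebra = cong (λ l → concat l ++ false ∷ []) (tabulate-cong λ k → cong (true ∷_) (begin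
      listing (λ i j → encodeName F N (graphNames k i j))
        ≡⟨ cong concat (tabulate-cong λ i → cong concat (tabulate-cong λ j → encodeEntry k i (does (i ≟ j)))) ⟩
      listing (diagonal zeroLetter (letter ∘ code adjacent k))
        ≡⟨ listing-diagonal zeroLetter (n * n) (letter ∘ code adjacent k) ⟩
      zeroLetter ++ concat (tabulate λ p → copies zeroLetter (suc (n * n)) ++ letter (code adjacent k (suc p)))
        ≡⟨ cong (zeroLetter ++_) (concat-tabulate-* n n λ uv → copies zeroLetter (suc (n * n)) ++ letter (incident adjacent k uv)) ⟩
      matrixWord zeroLetter oneLetter (n * n) (unit k) adjacent ∎))
      where
      open ≡-Reasoning
      letter : Bool → Word
      letter = digit zeroLetter oneLetter
      encodeBit : ∀ b → encodeName F N (bitName b) ≡ letter b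
      encodeBit true  = refl
      encodeBit false = refl
      encodeEntry : ∀ k i b → encodeName F N (if b then bitName (code adjacent k i) else zeroName) ≡
                    (if b then letter (code adjacent k i) else zeroLetter)
      encodeEntry k i true  = encodeBit (code adjacent k i)
      encodeEntry k i false = refl

    lieAlgebra-good : Abelian F (LieAlgebra.elements lieAlgebra) × Diagonalizable F (LieAlgebra.elements lieAlgebra)
    lieAlgebra-good = span-abelian graphBasis offDiagonal , span-diagonalizable graphBasis offDiagonal

  -- From matched functionals to a graph isomorphism.

  module _ {n : ℕ} (G H : Adjacency n) (y : Fin n → Fin n → Carrier) where
    private
      module G = Adjacency G
      module H = Adjacency H
      _∼_ = Matched (code G.adjacent) (code H.adjacent) y

    -- Vertices are matched with vertices, which alone are nonzero and simple, so `y` is the matrix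
    -- of a permutation `σ`. Matchings then compare supports along `σ`: those of columns carry edges
    -- from `G` to `H`, those of rows carry them back.
    matched⇒isomorphic : (∀ i → ∃[ j ] i ∼ j) → (∀ j → ∃[ i ] i ∼ j) →
      (∀ j → Simple (code G.adjacent) j → ∃[ i ] i ∼ j × Simple (code H.adjacent) i) → G.graph ≅ H.graph
    matched⇒isomorphic row column column-simple = record
      { bijection = mk↔ₛ′ σ σ⁻¹ σσ⁻¹ λ v → σ-injective (σσ⁻¹ (σ v))
      ; preserves = λ s t → agree s t (G.adjacent s t) (H.adjacent (σ s) (σ t)) refl refl
      }
      where
      ∼-zero : ∀ i j k → i ∼ j → (∀ l → code H.adjacent l i ≡ false) → code G.adjacent k j ≡ false
      ∼-zero i j k i∼j vanish = bit-injective _ _ (≈-trans (≈-sym (i∼j k))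
        (sum-zero _ λ l → ≈-trans (*-congˡ {y k l} (reflexive (cong bit (vanish l)))) (zeroʳ (y k l))))

      vertexImage : ∀ v → ∃[ u ] pair u u ∼ pair v v
      vertexImage v with column-simple (pair v v) (vertex-simple G v)
      ... | i , i∼ , simple = go {i} (view {n} i) i∼ simple
        where
        ≢-zero : ∀ i → i ∼ pair v v → ¬ (∀ l → code H.adjacent l i ≡ false)
        ≢-zero i i∼ vanish = contradiction
          (trans (sym (∼-zero i (pair v v) v i∼ vanish)) (trans (code-vertex G.adjacent v v) (unit-refl v))) λ ()

        go : ∀ {i} → View i → i ∼ pair v v → (∀ i′ → (∀ l → code H.adjacent l i′ ≡ code H.adjacent l i) → i′ ≡ i) →
             ∃[ u ] pair u u ∼ pair v v
        go none i∼ simple = contradiction (λ l → refl) (≢-zero zero i∼)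
        go (both u u′) i∼ simple with u ≟ u′ | H.adjacent u u′ in uu′
        ... | yes refl | _     = u , i∼
        -- An edge occurs at the reversed pair as well, so simplicity would identify its ends.
        ... | no u≢u′  | true  = contradiction
          (proj₂ (combine-injective u′ u u u′ (suc-injective (simple (pair u′ u) λ l → code-symmetric H l u′ u)))) u≢u′
        ... | no u≢u′  | false = contradiction (λ l → code-nonadjacent H l u≢u′ uu′) (≢-zero (pair u u′) i∼)

      σ : Fin n → Fin n
      σ = proj₁ ∘ vertexImage

      -- The functional at the vertex `σ v` is a coordinate, so the matching there reads off a
      -- single entry of `y`.
      y-σ : ∀ k v → y k (σ v) ≈ bit (unit k v)
      y-σ k v = ≈-trans (≈-sym (weight-single (code H.adjacent) (y k) (pair (σ v) (σ v)) (σ v) λ l → code-vertex H.adjacent l (σ v)))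
        (≈-trans (proj₂ (vertexImage v) k) (reflexive (cong bit (code-vertex G.adjacent k v))))

      σ-injective : ∀ {u v} → σ u ≡ σ v → u ≡ v
      σ-injective {u} {v} σu≡σv = unit-true (trans (sym (bit-injective _ _
        (≈-trans (≈-sym (y-σ u u)) (≈-trans (reflexive (cong (y u) σu≡σv)) (y-σ u v))))) (unit-refl u))

      σ-surjective = injective⇒surjective σ σ-injective
      σ⁻¹ : Fin n → Fin n
      σ⁻¹ = proj₁ ∘ σ-surjective
      σσ⁻¹ : ∀ u → σ (σ⁻¹ u) ≡ u
      σσ⁻¹ = proj₂ ∘ σ-surjective

      -- `y k` is the standard basis vector at `σ k`, where the `i`-th functional takes one bit of
      -- the code as its value.
      ∼⇒code : ∀ i j → i ∼ j → ∀ k → code H.adjacent (σ k) i ≡ code G.adjacent k j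
      ∼⇒code i j i∼j k = bit-injective _ _ (≈-trans (≈-sym weight-σ) (i∼j k))
        where
        y-≢ : ∀ l → l ≢ σ k → y k l ≈ 0#
        y-≢ l l≢σk = ≈-trans (reflexive (cong (y k) (sym (σσ⁻¹ l))))
          (≈-trans (y-σ k (σ⁻¹ l)) (reflexive (cong bit (unit-false λ k≡ → l≢σk (trans (sym (σσ⁻¹ l)) (cong σ (sym k≡)))))))
        weight-σ : weight (code H.adjacent) (y k) i ≈ bit (code H.adjacent (σ k) i)
        weight-σ = ≈-trans (sum-single _ (σ k) λ l l≢σk → ≈-trans (*-congʳ (y-≢ l l≢σk)) (zeroˡ _))
          (≈-trans (*-congʳ (≈-trans (y-σ k k) (reflexive (cong bit (unit-refl k))))) (*-identityˡ _))

      adjacent⇒≢ : ∀ (K : Adjacency n) {s t} → Adjacency.adjacent K s t ≡ true → s ≢ t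
      adjacent⇒≢ K {s} st refl = contradiction (trans (sym (Adjacency.irreflexive K s)) st) λ ()

      edge⇒edge : ∀ {s t} → G.adjacent s t ≡ true → H.adjacent (σ s) (σ t) ≡ true
      edge⇒edge {s} {t} st = let i , i∼ = column (pair s t) in
        code-edge H i (adjacent⇒≢ G st ∘ σ-injective)
        (trans (∼⇒code i (pair s t) i∼ s) (code-source G st)) (trans (∼⇒code i (pair s t) i∼ t) (code-target G st))

      edge⇐edge : ∀ {s t} → H.adjacent (σ s) (σ t) ≡ true → G.adjacent s t ≡ true
      edge⇐edge {s} {t} st = let j , ∼j = row (pair (σ s) (σ t)) in
        code-edge G j (adjacent⇒≢ H st ∘ cong σ)
        (trans (sym (∼⇒code (pair (σ s) (σ t)) j ∼j s)) (code-source H st)) (trans (sym (∼⇒code (pair (σ s) (σ t)) j ∼j t)) (code-target H st))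

      agree : ∀ s t b c → G.adjacent s t ≡ b → H.adjacent (σ s) (σ t) ≡ c → G.adjacent s t ≡ H.adjacent (σ s) (σ t)
      agree s t true  c     p q = trans p (sym (edge⇒edge p))
      agree s t false true  p q = contradiction (trans (sym p) (edge⇐edge q)) λ ()
      agree s t false false p q = trans p (sym q)

  -- Isomorphism and conjugacy for graphs of equal order.

  module _ {n : ℕ} (G H : Adjacency n) where
    private
      module G = Adjacency G
      module H = Adjacency H
      L₁ = LieAlgebra.elements (lieAlgebra G)
      L₂ = LieAlgebra.elements (lieAlgebra H)

    isomorphic⇒conjugate : G.graph ≅ H.graph → Conjugator F L₁ L₂
    isomorphic⇒conjugate G≅H = permutation-conjugator ρ σ (graphBasis G) (graphBasis H)
      -- The permuted names agree word for word.
      λ k i j → reflexive (cong₂ (λ b c → ⟦ if b then bitName c else zeroName ⟧) (same-≟ i j) (same-code k i))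
      where
      open _≅_ G≅H renaming (bijection to σ)
      ρ : Permutation′ (suc (n * n))
      -- Fixes the index `zero` and applies `σ` to both members of a pair.
      ρ = lift₀ (↔-trans *↔× (↔-trans (σ ×-↔ σ) (↔-sym *↔×)))

      same-≟ : ∀ i j → does (i ≟ j) ≡ does ((ρ ⟨$⟩ˡ i) ≟ (ρ ⟨$⟩ˡ j))
      same-≟ i j = does-⇔ (mk⇔ (cong (ρ ⟨$⟩ˡ_)) λ e →
        trans (sym (Perm.inverseʳ ρ)) (trans (cong (ρ ⟨$⟩ʳ_) e) (Perm.inverseʳ ρ)))
        (i ≟ j) ((ρ ⟨$⟩ˡ i) ≟ (ρ ⟨$⟩ˡ j))

      same-unit : ∀ k u → unit (σ ⟨$⟩ʳ k) u ≡ unit k (σ ⟨$⟩ˡ u)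
      same-unit k u = does-⇔ (mk⇔ (λ e → trans (sym (Perm.inverseˡ σ)) (cong (σ ⟨$⟩ˡ_) e))
                                  (λ e → trans (cong (σ ⟨$⟩ʳ_) e) (Perm.inverseʳ σ))) ((σ ⟨$⟩ʳ k) ≟ u) (k ≟ (σ ⟨$⟩ˡ u))

      same-code : ∀ k i → code H.adjacent (σ ⟨$⟩ʳ k) i ≡ code G.adjacent k (ρ ⟨$⟩ˡ i)
      same-code k i with view {n} i
      ... | none     = refl
      ... | both u v = begin
        code H.adjacent (σ ⟨$⟩ʳ k) (pair u v)            ≡⟨ code-pair H.adjacent (σ ⟨$⟩ʳ k) u v ⟩
        incident H.adjacent (σ ⟨$⟩ʳ k) (u , v)           ≡⟨ cong₂ (λ x y → vote x y (H.adjacent u v)) (same-unit k u) (same-unit k v) ⟩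
        vote (unit k (σ ⟨$⟩ˡ u)) (unit k (σ ⟨$⟩ˡ v)) (H.adjacent u v)
                                                         ≡⟨ cong (vote (unit k (σ ⟨$⟩ˡ u)) (unit k (σ ⟨$⟩ˡ v)))
                                                              (trans (preserves (σ ⟨$⟩ˡ u) (σ ⟨$⟩ˡ v)) (cong₂ H.adjacent (Perm.inverseʳ σ) (Perm.inverseʳ σ))) ⟨
        incident G.adjacent k (σ ⟨$⟩ˡ u , σ ⟨$⟩ˡ v)      ≡⟨ code-pair G.adjacent k (σ ⟨$⟩ˡ u) (σ ⟨$⟩ˡ v) ⟨
        code G.adjacent k (pair (σ ⟨$⟩ˡ u) (σ ⟨$⟩ˡ v))   ≡⟨ cong (λ (u , v) → code G.adjacent k (pair (σ ⟨$⟩ˡ u) (σ ⟨$⟩ˡ v))) (remQuot-combine u v) ⟨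
        code G.adjacent k (ρ ⟨$⟩ˡ pair u v)              ∎
        where open ≡-Reasoning

    conjugate⇒isomorphic : Conjugator F L₁ L₂ → G.graph ≅ H.graph
    conjugate⇒isomorphic C = matched⇒isomorphic G H (coordinates G-spans H-spans C)
      (row-matched G-spans H-spans C) (column-matched G-spans H-spans C) (column-matched-simple G-spans H-spans C)
      where
      G-spans = graphBasis-spans G
      H-spans = graphBasis-spans H

    liePair : LiePair F N
    liePair = record { size = suc (n * n) ; L₁ = lieAlgebra G ; L₂ = lieAlgebra H }

  -- Graphs of different orders are sent to the algebras of these two.
  edgeGraph emptyGraph : Adjacency 2
  edgeGraph = record
    { adjacent    = λ i j → not (unit i j)
    ; symmetric   = λ i j → cong not (does-⇔ (mk⇔ sym sym) (i ≟ j) (j ≟ i))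
    ; irreflexive = λ i → cong not (unit-refl i)
    }
  emptyGraph = record { adjacent = λ _ _ → false ; symmetric = λ _ _ → refl ; irreflexive = λ _ → refl }

  edge≇empty : ¬ Adjacency.graph edgeGraph ≅ Adjacency.graph emptyGraph
  edge≇empty G≅H = contradiction (_≅_.preserves G≅H zero (suc zero)) λ ()

  -- A `LiePair` has one common size, so graphs of different orders cannot be passed on directly.
  select : ∀ {m n} → Adjacency m → Adjacency n → Dec (m ≡ n) → LiePair F N
  select G H (yes refl) = liePair G H
  select G H (no _)     = liePair edgeGraph emptyGraph

  select-good : ∀ {m n} (G : Adjacency m) (H : Adjacency n) d → AbelianDiagonalizable F N (select G H d)
  select-good G H (yes refl) = lieAlgebra-good G , lieAlgebra-good H
  select-good G H (no _)     = lieAlgebra-good edgeGraph , lieAlgebra-good emptyGraph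

  select-correct : ∀ {m n} (G : Adjacency m) (H : Adjacency n) d →
    (Adjacency.graph G ≅ Adjacency.graph H) ⇔ Problem.Solution (LAC F N) (select G H d)
  select-correct G H (yes refl) = mk⇔ (isomorphic⇒conjugate G H) (conjugate⇒isomorphic G H)
  select-correct G H (no m≢n)   = mk⇔
    (λ G≅H → contradiction (Perm.↔⇒≡ (_≅_.bijection G≅H)) m≢n)
    -- That the fixed pair is not conjugate is an instance of the equal-order case.
    (λ C → contradiction (conjugate⇒isomorphic edgeGraph emptyGraph C) edge≇empty)

  -- The reduction and its running time.

  encodePair : LiePair F N → Word
  encodePair = Problem.encode (LAC F N)

  encode-liePair : ∀ {n} (G H : Adjacency n) → encodePair (liePair G H) ≡
    unary (suc (n * n)) ++ algebraWord zeroLetter oneLetter (Adjacency.adjacent G) ++ algebraWord zeroLetter oneLetter (Adjacency.adjacent H)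
  encode-liePair {n} G H = cong (unary (suc (n * n)) ++_) (cong₂ _++_ (encode-lieAlgebra G) (encode-lieAlgebra H))

  reduction : Program 6
  reduction = convert zeroLetter oneLetter (encodePair (liePair edgeGraph emptyGraph))

  reductionTime : ℕ → ℕ
  reductionTime = convertTime zeroLetter oneLetter (encodePair (liePair edgeGraph emptyGraph))

  reduction-runs : ∀ {m n} (G : Adjacency m) (H : Adjacency n) d → ∃[ us ]
    (reduction ⊢ initialTapes (input (Adjacency.adjacent G) (Adjacency.adjacent H))
      ⇒[ reductionTime m ] us) ×
    readTape (lookup us 1F) ≡ encodePair (select G H d)
  reduction-runs G H (yes refl) =
    let us , run , out = runs-convert-equal zeroLetter oneLetter _ (Adjacency.adjacent G) (Adjacency.adjacent H)
    in us , run , trans out (sym (encode-liePair G H))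
  reduction-runs G H (no m≢n) =
    runs-convert-unequal zeroLetter oneLetter _ (Adjacency.adjacent G) (Adjacency.adjacent H) m≢n

  encodeGraphs : ∀ {m n} (G : Adjacency m) (H : Adjacency n) →
    encodeGraph (Adjacency.graph G) ++ encodeGraph (Adjacency.graph H) ≡
    input (Adjacency.adjacent G) (Adjacency.adjacent H)
  encodeGraphs {m} {n} G H = begin
    (unary m ++ listing (λ i j → [ G.adjacent i j ])) ++ unary n ++ listing (λ i j → [ H.adjacent i j ])
      ≡⟨ cong₂ (λ v w → (unary m ++ v) ++ unary n ++ w) (listing-bits G.adjacent) (listing-bits H.adjacent) ⟩
    (unary m ++ rows G.adjacent) ++ unary n ++ rows H.adjacent
      ≡⟨ ++-assoc (unary m) (rows G.adjacent) (unary n ++ rows H.adjacent) ⟩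
    unary m ++ rows G.adjacent ++ unary n ++ rows H.adjacent
      ≡⟨ cong (λ w → unary m ++ rows G.adjacent ++ w) (unary-++ n (rows H.adjacent)) ⟩
    unary m ++ rows G.adjacent ++ replicate n true ++ false ∷ rows H.adjacent
      ≡⟨ unary-++ m (rows G.adjacent ++ replicate n true ++ false ∷ rows H.adjacent) ⟩
    input G.adjacent H.adjacent ∎
    where
    open ≡-Reasoning
    module G = Adjacency G
    module H = Adjacency H
    unary-++ : ∀ n w → unary n ++ w ≡ replicate n true ++ false ∷ w
    unary-++ n w = ++-assoc (replicate n true) (false ∷ []) w
    concat-singletons : ∀ {n} (b : Fin n → Bool) → concat (tabulate λ j → [ b j ]) ≡ tabulate b
    concat-singletons {zero}  b = refl
    concat-singletons {suc n} b = cong (b zero ∷_) (concat-singletons (b ∘ suc))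
    listing-bits : ∀ {n} (a : Fin n → Fin n → Bool) → listing (λ i j → [ a i j ]) ≡ rows a
    listing-bits a = cong concat (tabulate-cong λ i → concat-singletons (a i))

  -- The order is written in unary, so a bound polynomial in the order is polynomial in the input
  -- length.
  vertices≤encode : ∀ (G : Graph) w → Graph.vertices G ≤ length (encodeGraph G ++ w)
  vertices≤encode G w = begin
    n                                        ≡⟨ length-replicate n ⟨
    length (replicate n true)                ≤⟨ m≤m+n _ 1 ⟩
    length (replicate n true) + 1            ≡⟨ length-++ (replicate n true) ⟨
    length (unary n)                         ≤⟨ m≤m+n _ _ ⟩
    length (unary n) + length bits           ≡⟨ length-++ (unary n) ⟨
    length (encodeGraph G)                   ≤⟨ m≤m+n _ (length w) ⟩
    length (encodeGraph G) + length w        ≡⟨ length-++ (encodeGraph G) ⟨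
    length (encodeGraph G ++ w)              ∎
    where
    open ℕ.≤-Reasoning
    n = Graph.vertices G
    bits = listing (λ i j → Graph.adjacent G i j ∷ [])

  reduce : Graph × Graph → Problem.Instance (abelianDiagonalizableLAC F N)
  reduce (G , H) = select G′ H′ d , select-good G′ H′ d
    where
    G′ = adjacency G
    H′ = adjacency H
    d  = Graph.vertices G ℕ.≟ Graph.vertices H

  reduce-polynomialTime : PolynomialTime (Problem.encode GI) (Problem.encode (abelianDiagonalizableLAC F N)) reduce
  reduce-polynomialTime = program⇒polynomialTime
    (Problem.encode GI) (Problem.encode (abelianDiagonalizableLAC F N)) reduce
    reduction {reductionTime} (Graph.vertices ∘ proj₁)
    (poly-convertTime zeroLetter oneLetter (encodePair (liePair edgeGraph emptyGraph)))
    (λ (G , H) → vertices≤encode G (encodeGraph H))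
    λ (G , H) → let us , run , out = reduction-runs (adjacency G) (adjacency H) (Graph.vertices G ℕ.≟ Graph.vertices H) in
      us , subst (λ w → reduction ⊢ initialTapes w ⇒[ reductionTime (Graph.vertices G) ] us)
             (sym (encodeGraphs (adjacency G) (adjacency H))) run , out

corollary2p3 : ∀ {c ℓ₁ ℓ₂} (F : HeytingField c ℓ₁ ℓ₂) (N : Notation F) →
    GI ≤ₚ abelianDiagonalizableLAC F N
corollary2p3 F N = reduce F N , reduce-polynomialTime F N ,
  λ (G , H) → select-correct F N (adjacency G) (adjacency H) (Graph.vertices G ℕ.≟ Graph.vertices H)
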